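{- Let $T$ be a (finite) forest with at least one edge and let $k\geq 4$ be an integer. Then, as $n\to\infty$, $$\mathrm{ex}_k(n, T^{(k)}) = \left( \sigma(T) -1+o(1)\right)\binom{n}{k-1}.$$
   Context: For a graph $H$ and integer $k\ge 2$, the $k$-expansion $H^{(k)}$ is the $k$-uniform hypergraph obtained from $H$ by replacing each edge $xy$ of $H$ by a $k$-set $E_{xy}$ consisting of $x$, $y$ and $k-2$ new vertices, where the sets of new vertices $E_{xy}\setminus\{x,y\}$ are pairwise disjoint for distinct edges and disjoint from $V(H)$. For a forest $T$, $$\sigma(T):=\min\{|X|+e(T\setminus X): X\subseteq V(T)\text{ is an independent set in }T\},$$ where $T\setminus X$ is the forest obtained by deleting the vertices of $X$ and all edges incident to them, and $e(G)$ is the number of edges of $G$. $\mathrm{ex}_k(n,H)$ denotes the maximum number of edges of a $k$-uniform hypergraph $\mathcal{F}\subseteq\binom{[n]}{k}$ containing no subhypergraph isomorphic to $H$; the $o(1)$ term tends to $0$ as $n\to\infty$ with $T$ and $k$ fixed. -}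

module Defs where

open import Data.Nat using (ℕ; zero; suc; _+_; _*_; _∸_; _≤_; _<_)
open import Data.Nat.Combinatorics using (_C_)
open import Data.Bool using (Bool; true; false; if_then_else_; _∨_)
open import Data.Fin using (Fin; toℕ; inject₁; fromℕ) renaming (zero to fzero; suc to fsuc)
open import Data.Fin.Subset using (Subset; _∈_; ∣_∣)
open import Data.Vec using (lookup)
open import Data.List using (List; length; map)
open import Data.Nat.ListAction using (sum)
open import Data.List.Relation.Unary.Unique.Propositional using (Unique)
open import Data.List.Relation.Unary.All using (All)
import Data.List.Membership.Propositional as LM
open import Data.Product using (Σ; ∃; _×_; _,_; proj₁; proj₂)
open import Data.Sum using (_⊎_)
open import Data.Empty using (⊥)
open import Relation.Nullary using (¬_)
open import Relation.Binary.PropositionalEquality using (_≡_)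
open import Function.Definitions using (Injective)
open import Function using (_⇔_)

-- Finite simple graphs: vertex set Fin V, edges a duplicate-free list of
-- pairs (x , y) with x < y (so each edge {x,y} is listed exactly once).

record Graph : Set where
  field
    V       : ℕ
    E       : List (Fin V × Fin V)
    ordered : All (λ e → toℕ (proj₁ e) < toℕ (proj₂ e)) E
    unique  : Unique E
open Graph public

e : Graph → ℕ
e G = length (E G)

Adj : (G : Graph) → Fin (V G) → Fin (V G) → Set
Adj G x y = ((x , y) LM.∈ E G) ⊎ ((y , x) LM.∈ E G)

record Cycle (G : Graph) : Set where
  field
    l     : ℕ
    c     : Fin (3 + l) → Fin (V G)
    inj   : Injective _≡_ _≡_ c
    step  : (i : Fin (2 + l)) → Adj G (c (inject₁ i)) (c (fsuc i))
    close : Adj G (c (fromℕ (2 + l))) (c fzero)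

IsForest : Graph → Set
IsForest G = ¬ Cycle G

Independent : (G : Graph) → Subset (V G) → Set
Independent G X = All (λ xy → ¬ ((proj₁ xy ∈ X) × (proj₂ xy ∈ X))) (E G)

eMinus : (G : Graph) → Subset (V G) → ℕ
eMinus G X = sum (map (λ xy → if lookup X (proj₁ xy) ∨ lookup X (proj₂ xy) then 0 else 1) (E G))

IsSigma : Graph → ℕ → Set
IsSigma G s =
  (Σ (Subset (V G)) λ X → Independent G X × (∣ X ∣ + eMinus G X ≡ s))
  × ((X : Subset (V G)) → Independent G X → s ≤ ∣ X ∣ + eMinus G X)

record UHypergraph (k n : ℕ) : Set where
  field
    edges    : List (Subset n)
    uniform  : All (λ S → ∣ S ∣ ≡ k) edges
    distinct : Unique edges
open UHypergraph public

-- The k-expansion G^(k): vertex set V(G) ⊎ (edge index × Fin (k-2));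
-- the edge for the i-th edge (x , y) of G is {x , y} ∪ {(i , j) : j}.
ExpVertex : Graph → ℕ → Set
ExpVertex G k = Fin (V G) ⊎ (Fin (e G) × Fin (k ∸ 2))

InExpEdge : (G : Graph) (k : ℕ) → Fin (e G) → ExpVertex G k → Set
InExpEdge G k i (Data.Sum.inj₁ z) =
  (z ≡ proj₁ (Data.List.lookup (E G) i)) ⊎ (z ≡ proj₂ (Data.List.lookup (E G) i))
InExpEdge G k i (Data.Sum.inj₂ (i' , j)) = i' ≡ i

ContainsExpansion : {k n : ℕ} → UHypergraph k n → Graph → Set
ContainsExpansion {k} {n} F G =
  Σ (ExpVertex G k → Fin n) λ φ →
    Injective _≡_ _≡_ φ ×
    ((i : Fin (e G)) →
      Σ (Subset n) λ S → (S LM.∈ edges F) ×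
        ((z : Fin n) → (z ∈ S) ⇔ (Σ (ExpVertex G k) λ w → InExpEdge G k i w × (φ w ≡ z))))

{-# OPTIONS --safe #-}
module Submission where

-- Write q = k - 1 and σ = σ(T). The lower bound comes from the k-sets meeting a fixed set of σ - 1
-- vertices in exactly one vertex.
--
-- For the upper bound, repeatedly delete the edges through a q-set of small positive degree. If
-- something survives, every q-set in its shadow has large degree and T^(k) embeds greedily, leaf
-- by leaf. Otherwise every edge is charged to a q-set with boundedly many edges per q-set, so
-- more than (σ - 1 + ε) binom(n,q) edges give a positive proportion of q-sets D with σ charged
-- edges D ∪ {x_1(D)}, …, D ∪ {x_σ(D)}. For each j, either the edges D ∪ {x_j(D)} already allow a
-- greedy embedding, or x_j is constant on a positive proportion of the D; this needs q ≥ 3, so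
-- that a D with at most one bad vertex still has two good ones. Once all x_j are constant,
-- let X be an optimal independent set: the constants serve as the vertices of X and as one
-- expansion vertex for each edge of T ∖ X, and the rest of T is embedded greedily into the
-- dense family of the D.

open import Defs
open import Data.Bool using (Bool; true; false; not; _∨_; if_then_else_)
open import Data.Bool.Properties using (∨-zeroʳ)
import Data.Bool.Properties as Boolₚ
open import Data.Empty using (⊥; ⊥-elim)
open import Data.Fin using (Fin; toℕ; fromℕ<; inject≤; cast) renaming (zero to fzero; suc to fsuc)
import Data.Fin.Properties as Finₚ
open import Data.Fin.Subset using (Subset; inside; outside; _∪_; ⁅_⁆; ∣_∣; _-_; Nonempty) renaming (_∈_ to _∈ˢ_; _∉_ to _∉ˢ_; _⊆_ to _⊆ˢ_; ⊥ to ∅; ⊤ to full)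
open import Data.Fin.Subset.Properties
open import Data.List using (List; []; _∷_; length; map; filter; lookup; _++_; allFin; concatMap)
open import Data.List.Membership.Propositional using (_∈_; _∉_; find; lose)
open import Data.List.Membership.Propositional.Properties using (∈-filter⁺; ∈-filter⁻; ∈-lookup; ∈-map⁺; ∈-map⁻; ∈-allFin; ∈-++⁺ˡ; ∈-++⁺ʳ; ∈-++⁻; ∈-concatMap⁺)
open import Data.List.Properties using (length-map; length-++; length-tabulate; filter-notAll; map-tabulate; tabulate-lookup)
open import Data.List.Relation.Unary.All using ([]; _∷_)
import Data.List.Relation.Unary.All as All
open import Data.List.Relation.Unary.AllPairs using ([]; _∷_)
open import Data.List.Relation.Unary.Any using (here; there; index; any?)
import Data.List.Relation.Unary.Any as Any
open import Data.List.Relation.Unary.Any.Properties using (lookup-index)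
open import Data.List.Relation.Unary.Unique.Propositional using (Unique)
import Data.List.Relation.Unary.Unique.Propositional.Properties as Uniqueₚ
open import Data.Nat hiding (∣_-_∣)
open import Data.Nat.Combinatorics using (_C_; nCn≡1; nC1≡n; nCk≡nC[n∸k]; nCk+nC[k+1]≡[n+1]C[k+1])
open import Data.Nat.DivMod using (_/_; m/n*n≤m; m*n/n≡m; /-monoˡ-≤)
open import Data.Nat.ListAction using (sum)
open import Data.Nat.Properties
open import Data.Nat.Tactic.RingSolver using (solve-∀)
open import Data.Product using (Σ; ∃; _×_; _,_; proj₁; proj₂)
open import Data.Sum using (_⊎_; inj₁; inj₂; [_,_]′)
open import Data.Sum.Properties using (inj₁-injective; inj₂-injective)
open import Data.Vec using ([]; _∷_; here; there)
import Data.Vec as Vec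
import Data.Vec.Properties as Vecₚ
open import Data.Vec.Properties using ([]=⇒lookup; lookup⇒[]=; lookup∘tabulate)
open import Function using (_∘_; mk⇔; Equivalence)
open import Relation.Binary.Definitions using (DecidableEquality; tri<; tri≈; tri>)
open import Relation.Binary.PropositionalEquality
open import Relation.Nullary
open import Relation.Nullary.Decidable using (_×-dec_; _⊎-dec_; dec-true)
open import Relation.Unary using (Decidable)

-- The `o(1)` becomes an accuracy `1/m`, and a positive proportion becomes `n ^ q ≤ d * length L`
-- with `d` independent of `n`. Making one x_j constant worsens `d` by an amount depending only on
-- `d`, `q` and `κ`; as there are only σ rounds, a single threshold for `n` suffices.
--
-- The obstacle is that x_j(D) is not under control: many D through a vertex y may avoid all
-- vertices used so far while x_j(D) is itself a used vertex. This can block the embedding only when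
-- some value of x_j is popular among the sets through y, and popular values are exactly what leads
-- to a constant. An embedded edge needs two unproblematic vertices: the one where it is attached
-- and another at which later edges continue.
--
-- Once constant, an x_j is harmless: its value joins a list that the greedy embedding avoids from
-- the outset. All greedy arguments are a single one, run on the abstract notion `Spread`, where `κ`
-- bounds the number of vertices that a partial copy and the constants occupy.

private variable
  A B : Set
  n : ℕ

-- Counting in lists: double counting, union bounds, pigeonholes, pruning.

+-exchange : ∀ a b c → a + (b + c) ≡ b + (a + c)
+-exchange = solve-∀

# : {P : A → Set} → Decidable P → List A → ℕ
# P? xs = length (filter P? xs)

#-mono : {P Q : A → Set} (P? : Decidable P) (Q? : Decidable Q) (xs : List A) →
         (∀ {x} → x ∈ xs → P x → Q x) → # P? xs ≤ # Q? xs
#-mono P? Q? [] h = z≤n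
#-mono P? Q? (x ∷ xs) h with P? x | Q? x
... | yes p | yes q = s≤s (#-mono P? Q? xs (h ∘ there))
... | yes p | no ¬q = contradiction (h (here refl) p) ¬q
... | no _  | yes _ = m≤n⇒m≤1+n (#-mono P? Q? xs (h ∘ there))
... | no _  | no _  = #-mono P? Q? xs (h ∘ there)

#-⊎ : {P Q R : A → Set} (P? : Decidable P) (Q? : Decidable Q) (R? : Decidable R) (xs : List A) →
      (∀ {x} → x ∈ xs → P x → Q x ⊎ R x) → # P? xs ≤ # Q? xs + # R? xs
#-⊎ P? Q? R? [] h = z≤n
#-⊎ P? Q? R? (x ∷ xs) h with P? x | Q? x | R? x | #-⊎ P? Q? R? xs (h ∘ there)
... | yes p | no ¬q | no ¬r | _ = ⊥-elim ([ ¬q , ¬r ]′ (h (here refl) p))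
... | yes p | no ¬q | yes r | i = ≤-trans (s≤s i) (≤-reflexive (sym (+-suc _ _)))
... | yes p | yes q | yes r | i = s≤s (≤-trans i (+-monoʳ-≤ _ (n≤1+n _)))
... | yes p | yes q | no ¬r | i = s≤s i
... | no _  | yes q | yes r | i = m≤n⇒m≤1+n (≤-trans i (+-monoʳ-≤ _ (n≤1+n _)))
... | no _  | yes q | no ¬r | i = m≤n⇒m≤1+n i
... | no _  | no _  | yes r | i = ≤-trans i (+-monoʳ-≤ _ (n≤1+n _))
... | no _  | no _  | no _  | i = i

#-filter : {P Q : A → Set} (P? : Decidable P) (Q? : Decidable Q) (xs : List A) →
           # Q? (filter P? xs) ≡ # (λ x → P? x ×-dec Q? x) xs
#-filter P? Q? [] = refl
#-filter P? Q? (x ∷ xs) with P? x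
... | no _ = #-filter P? Q? xs
... | yes _ with Q? x
...   | yes _ = cong suc (#-filter P? Q? xs)
...   | no _  = #-filter P? Q? xs

length≤#+# : {P : A → Set} (P? : Decidable P) (xs : List A) → length xs ≤ # P? xs + # (¬? ∘ P?) xs
length≤#+# P? [] = z≤n
length≤#+# P? (x ∷ xs) with P? x
... | yes _ = s≤s (length≤#+# P? xs)
... | no  _ = ≤-trans (s≤s (length≤#+# P? xs)) (≤-reflexive (sym (+-suc _ _)))

#>0⇒∃ : {P : A → Set} (P? : Decidable P) (xs : List A) → 1 ≤ # P? xs → ∃ λ x → x ∈ xs × P x
#>0⇒∃ P? xs h with filter P? xs in eq
#>0⇒∃ P? xs () | []
... | y ∷ ys = y , ∈-filter⁻ P? (subst (y ∈_) (sym eq) (here refl))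

∈⇒length>0 : {x : A} {xs : List A} → x ∈ xs → 1 ≤ length xs
∈⇒length>0 (here _)  = s≤s z≤n
∈⇒length>0 (there _) = s≤s z≤n

length>0⇒∃ : {xs : List A} → 1 ≤ length xs → ∃ λ x → x ∈ xs
length>0⇒∃ {xs = x ∷ _} _ = x , here refl

sum-cong-≤ : (f g : A → ℕ) (xs : List A) → (∀ {x} → x ∈ xs → f x ≤ g x) →
             sum (map f xs) ≤ sum (map g xs)
sum-cong-≤ f g [] h = z≤n
sum-cong-≤ f g (x ∷ xs) h = +-mono-≤ (h (here refl)) (sum-cong-≤ f g xs (h ∘ there))

sum-const : (c : ℕ) (xs : List A) → sum (map (λ _ → c) xs) ≡ length xs * c
sum-const c [] = refl
sum-const c (x ∷ xs) = cong (c +_) (sum-const c xs)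

sum-*ˡ : (c : ℕ) (f : A → ℕ) (xs : List A) → sum (map (λ x → c * f x) xs) ≡ c * sum (map f xs)
sum-*ˡ c f [] = sym (*-zeroʳ c)
sum-*ˡ c f (x ∷ xs) = trans (cong (c * f x +_) (sum-*ˡ c f xs)) (sym (*-distribˡ-+ c (f x) _))

module _ {R : B → A → Set} (R? : ∀ y → Decidable (R y)) where

  sum-#-[] : (ys : List B) → sum (map (λ y → # (R? y) []) ys) ≡ 0
  sum-#-[] [] = refl
  sum-#-[] (y ∷ ys) = sum-#-[] ys

  sum-#-∷ : (x : A) (xs : List A) (ys : List B) → sum (map (λ y → # (R? y) (x ∷ xs)) ys) ≡
            # (λ y → R? y x) ys + sum (map (λ y → # (R? y) xs) ys)
  sum-#-∷ x xs [] = refl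
  sum-#-∷ x xs (y ∷ ys) with R? y x
  ... | yes _ = cong suc (trans (cong (# (R? y) xs +_) (sum-#-∷ x xs ys)) (+-exchange (# (R? y) xs) (# (λ y → R? y x) ys) _))
  ... | no _ = trans (cong (# (R? y) xs +_) (sum-#-∷ x xs ys)) (+-exchange (# (R? y) xs) (# (λ y → R? y x) ys) _)

  double-counting : (xs : List A) (ys : List B) →
    sum (map (λ y → # (R? y) xs) ys) ≡ sum (map (λ x → # (λ y → R? y x) ys) xs)
  double-counting [] ys = sum-#-[] ys
  double-counting (x ∷ xs) ys =
    trans (sum-#-∷ x xs ys) (cong (# (λ y → R? y x) ys +_) (double-counting xs ys))

  length≤sum-# : (xs : List A) (ys : List B) → (∀ {x} → x ∈ xs → ∃ λ y → y ∈ ys × R y x) →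
                 length xs ≤ sum (map (λ y → # (R? y) xs) ys)
  length≤sum-# xs ys h = begin
    length xs                                  ≡⟨ *-identityʳ _ ⟨
    length xs * 1                              ≡⟨ sum-const 1 xs ⟨
    sum (map (λ _ → 1) xs)                     ≤⟨ sum-cong-≤ _ _ xs one ⟩
    sum (map (λ x → # (λ y → R? y x) ys) xs)   ≡⟨ double-counting xs ys ⟨
    sum (map (λ y → # (R? y) xs) ys)           ∎
    where
    open ≤-Reasoning
    one : ∀ {x} → x ∈ xs → 1 ≤ # (λ y → R? y x) ys
    one {x} x∈ with h x∈
    ... | y , y∈ , r = ∈⇒length>0 (∈-filter⁺ (λ y → R? y x) y∈ r)

  union-bound : (xs : List A) (ys : List B) (b : ℕ) →
    (∀ {x} → x ∈ xs → ∃ λ y → y ∈ ys × R y x) → (∀ {y} → y ∈ ys → # (R? y) xs ≤ b) →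
    length xs ≤ length ys * b
  union-bound xs ys b cov bd = begin
    length xs                         ≤⟨ length≤sum-# xs ys cov ⟩
    sum (map (λ y → # (R? y) xs) ys)  ≤⟨ sum-cong-≤ _ _ ys bd ⟩
    sum (map (λ _ → b) ys)            ≡⟨ sum-const b ys ⟩
    length ys * b                     ∎
    where open ≤-Reasoning

  -- Double counting with degrees at least `b / g` on one side and at most `c` on the other; the
  -- factor `g` replaces the division.
  degree-bound : (xs : List A) (ys : List B) (g b c : ℕ) →
    (∀ {y} → y ∈ ys → b ≤ g * # (R? y) xs) → (∀ {x} → x ∈ xs → # (λ y → R? y x) ys ≤ c) →
    length ys * b ≤ g * (length xs * c)
  degree-bound xs ys g b c lo hi = begin
    length ys * b                                  ≡⟨ sum-const b ys ⟨
    sum (map (λ _ → b) ys)                         ≤⟨ sum-cong-≤ _ _ ys lo ⟩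
    sum (map (λ y → g * # (R? y) xs) ys)           ≡⟨ sum-*ˡ g _ ys ⟩
    g * sum (map (λ y → # (R? y) xs) ys)           ≡⟨ cong (g *_) (double-counting xs ys) ⟩
    g * sum (map (λ x → # (λ y → R? y x) ys) xs)   ≤⟨ *-monoʳ-≤ g (sum-cong-≤ _ _ xs hi) ⟩
    g * sum (map (λ _ → c) xs)                     ≡⟨ cong (g *_) (sum-const c xs) ⟩
    g * (length xs * c)                            ∎
    where open ≤-Reasoning

  -- If every class were below average, the classes together could not cover `xs`. The average is
  -- written as a product to stay within the natural numbers.
  pigeonhole : (xs : List A) (ys : List B) → 1 ≤ length xs →
    (∀ {x} → x ∈ xs → ∃ λ y → y ∈ ys × R y x) →
    ∃ λ y → y ∈ ys × length xs ≤ length ys * # (R? y) xs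
  pigeonhole xs ys 1≤ cov with any? (λ y → length xs ≤? length ys * # (R? y) xs) ys
  ... | yes a = find a
  ... | no ¬a = contradiction total (n≮n _)
    where
    open ≤-Reasoning
    small : ∀ {y} → y ∈ ys → suc (length ys * # (R? y) xs) ≤ length xs
    small y∈ = ≰⇒> (λ p → ¬a (lose y∈ p))
    ys>0 : 1 ≤ length ys
    ys>0 = ∈⇒length>0 (proj₁ (proj₂ (cov (proj₂ (length>0⇒∃ 1≤)))))
    total : length ys * length xs < length ys * length xs
    total = begin-strict
      length ys * length xs                                   ≤⟨ *-monoʳ-≤ (length ys) (length≤sum-# xs ys cov) ⟩
      length ys * sum (map (λ y → # (R? y) xs) ys)            ≡⟨ sum-*ˡ (length ys) _ ys ⟨
      sum (map (λ y → length ys * # (R? y) xs) ys)            <⟨ +-monoˡ-≤ _ ys>0 ⟩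
      length ys + sum (map (λ y → length ys * # (R? y) xs) ys) ≡⟨ shift (λ y → length ys * # (R? y) xs) ys ⟩
      sum (map (λ y → suc (length ys * # (R? y) xs)) ys)      ≤⟨ sum-cong-≤ _ _ ys small ⟩
      sum (map (λ _ → length xs) ys)                          ≡⟨ sum-const (length xs) ys ⟩
      length ys * length xs                                   ∎
      where
      shift : ∀ (f : B → ℕ) zs → length zs + sum (map f zs) ≡ sum (map (λ z → suc (f z)) zs)
      shift f [] = refl
      shift f (z ∷ zs) = cong suc (trans (+-exchange (length zs) (f z) _) (cong (f z +_) (shift f zs)))

-- Each forbidden `u` excludes at most `b` candidates, so they cannot exclude all of them. This is
-- the selection step behind every construction of a `Spread`.
avoid : {P : A → Set} {R : B → A → Set} (P? : Decidable P) (R? : ∀ u → Decidable (R u))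
        (xs : List A) (us : List B) (b : ℕ) →
        (∀ {u} → u ∈ us → # (λ x → P? x ×-dec R? u x) xs ≤ b) → length us * b < # P? xs →
        ∃ λ x → x ∈ xs × P x × (∀ {u} → u ∈ us → ¬ R u x)
avoid {P = P} {R} P? R? xs us b bd big
  with any? (λ x → P? x ×-dec ¬? (any? (λ u → R? u x) us)) xs
... | yes a = let (x , x∈ , px , nr) = find a in x , x∈ , px , λ u∈ r → nr (lose u∈ r)
... | no ¬a = contradiction big (≤⇒≯ (union-bound R? (filter P? xs) us b cov bd′))
  where
  cov : ∀ {x} → x ∈ filter P? xs → ∃ λ u → u ∈ us × R u x
  cov {x} x∈ with ∈-filter⁻ P? x∈ | any? (λ u → R? u x) us
  ... | x∈xs , px | yes a = find a
  ... | x∈xs , px | no ¬b = contradiction (lose x∈xs (px , ¬b)) ¬a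
  bd′ : ∀ {u} → u ∈ us → # (R? u) (filter P? xs) ≤ b
  bd′ {u} u∈ = ≤-trans (≤-reflexive (#-filter P? (R? u) xs)) (bd u∈)

lookup-injective : {xs : List A} → Unique xs → ∀ {i j} → lookup xs i ≡ lookup xs j → i ≡ j
lookup-injective (_ ∷ _)   {fzero}  {fzero}  _  = refl
lookup-injective (p ∷ _)   {fzero}  {fsuc j} eq = contradiction eq (All.lookup p (∈-lookup j))
lookup-injective (p ∷ _)   {fsuc i} {fzero}  eq = contradiction (sym eq) (All.lookup p (∈-lookup i))
lookup-injective (_ ∷ u)   {fsuc i} {fsuc j} eq = cong fsuc (lookup-injective u eq)

index-injective : {xs : List A} {x y : A} (p : x ∈ xs) (q : y ∈ xs) → index p ≡ index q → x ≡ y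
index-injective {xs = xs} p q eq = trans (lookup-index p) (trans (cong (lookup xs) eq) (sym (lookup-index q)))

-- Choosing one partner for each `x` gives an injection of indices, since elements with a common
-- partner coincide. The relation `f` need not be functional.
length-≤-by : {f : A → B → Set} {xs : List A} {ys : List B} → Unique xs →
  (∀ {x} → x ∈ xs → ∃ λ y → y ∈ ys × f x y) → (∀ {x x′ y} → f x y → f x′ y → x ≡ x′) →
  length xs ≤ length ys
length-≤-by {f = f} {xs} {ys} u h inj = Finₚ.injective⇒≤ {f = g} g-inj
  where
  g : Fin (length xs) → Fin (length ys)
  g i = index (proj₁ (proj₂ (h (∈-lookup i))))
  g-inj : ∀ {i j} → g i ≡ g j → i ≡ j
  g-inj {i} {j} eq with h (∈-lookup {xs = xs} i) | h (∈-lookup {xs = xs} j)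
  ... | y , y∈ , r | y′ , y∈′ , r′ = lookup-injective u
    (inj r (subst (f _) (sym (index-injective y∈ y∈′ eq)) r′))

Unique-⊆⇒length≤ : {xs ys : List A} → Unique xs → (∀ {x} → x ∈ xs → x ∈ ys) → length xs ≤ length ys
Unique-⊆⇒length≤ u h = length-≤-by {f = _≡_} u (λ x∈ → _ , h x∈ , refl) λ p q → trans p (sym q)

-- Repeatedly removing everything incident to a feature of degree at most b either stops at a
-- nonempty full sublist or exhausts the list, in which case each element is charged to the
-- feature with which it was removed.
module _ (_≟B_ : DecidableEquality B) {R : B → A → Set} (R? : ∀ y → Decidable (R y))
         (ys : List B) (b : ℕ) where

  Full : List A → Set
  Full xs = ∀ {y x} → y ∈ ys → x ∈ xs → R y x → b < # (R? y) xs

  Charging : List A → Set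
  Charging xs = Σ (A → B) λ a → (∀ {x} → x ∈ xs → a x ∈ ys × R (a x) x) ×
                                (∀ y → # (λ x → a x ≟B y) xs ≤ b)

  prune : B → (fuel : ℕ) (xs : List A) → Unique xs → length xs ≤ fuel →
          (Σ (List A) λ xs′ → 1 ≤ length xs′ × Unique xs′ × (∀ {x} → x ∈ xs′ → x ∈ xs) × Full xs′)
          ⊎ Charging xs
  -- The charge must be a total function; `y₀` is its value wherever no removal sets it.
  prune y₀ f [] u le = inj₂ ((λ _ → y₀) , (λ ()) , λ _ → z≤n)
  prune y₀ (suc f) xs@(x₀ ∷ xs₀) u le
    with any? (λ y → (1 ≤? # (R? y) xs) ×-dec (# (R? y) xs ≤? b)) ys
  ... | no ¬a = inj₁ (xs , s≤s z≤n , u , (λ z → z) ,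
      λ {y} y∈ x∈ r → ≰⇒> λ le′ → ¬a (lose y∈ (∈⇒length>0 (∈-filter⁺ (R? y) x∈ r) , le′)))
  ... | yes a with find a
  ... | y , y∈ , lo , hi with #>0⇒∃ (R? y) xs lo
  ... | x₁ , x₁∈ , r₁
    with prune y₀ f (filter (¬? ∘ R? y) xs) (Uniqueₚ.filter⁺ (¬? ∘ R? y) u)
               (≤-pred (≤-trans (filter-notAll (¬? ∘ R? y) xs (lose x₁∈ (λ n → n r₁))) le))
  ... | inj₁ (xs′ , ne , u′ , sub , full) =
        inj₁ (xs′ , ne , u′ , (λ p → proj₁ (∈-filter⁻ (¬? ∘ R? y) (sub p))) , (λ {y} {x} → full {y} {x}))
  ... | inj₂ (a₁ , ok , bd) = inj₂ (a′ , ok′ , bd′)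
    where
    ys′ = filter (¬? ∘ R? y) xs
    a′ : A → B
    a′ x with R? y x
    ... | yes _ = y
    ... | no _  = a₁ x
    ok′ : ∀ {x} → x ∈ xs → a′ x ∈ ys × R (a′ x) x
    ok′ {x} x∈ with R? y x
    ... | yes r = y∈ , r
    ... | no ¬r = ok (∈-filter⁺ (¬? ∘ R? y) x∈ ¬r)
    toY : ∀ {x} → x ∈ xs → a′ x ≡ y → R y x
    toY {x} x∈ eq with R? y x
    ... | yes r = r
    ... | no ¬r = subst (λ z → R z x) eq (proj₂ (ok (∈-filter⁺ (¬? ∘ R? y) x∈ ¬r)))
    toZ : ∀ z → z ≢ y → ∀ zs → # (λ x → a′ x ≟B z) zs ≤ # (λ x → a₁ x ≟B z) (filter (¬? ∘ R? y) zs)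
    toZ z z≢ [] = z≤n
    toZ z z≢ (x ∷ zs) with R? y x
    ... | yes r with y ≟B z
    ...   | yes eq = contradiction (sym eq) z≢
    ...   | no _ = toZ z z≢ zs
    toZ z z≢ (x ∷ zs) | no ¬r with a₁ x ≟B z
    ...   | yes _ = s≤s (toZ z z≢ zs)
    ...   | no _  = toZ z z≢ zs
    -- Whatever is charged to `y` is incident to `y` in the current list, hence at most `b`
    -- elements; any other feature receives its charges from the recursive call alone.
    bd′ : ∀ z → # (λ x → a′ x ≟B z) xs ≤ b
    bd′ z with z ≟B y
    ... | yes refl = ≤-trans (#-mono (λ x → a′ x ≟B z) (R? z) xs toY) hi
    ... | no z≢ = ≤-trans (toZ z z≢ xs) (bd z)

-- Finite sets: adding and removing elements, counting supersets.

_≟ˢ_ : DecidableEquality (Subset n)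
_≟ˢ_ = Vecₚ.≡-dec Boolₚ._≟_

∣p∪⁅x⁆∣≡1+∣p∣ : (p : Subset n) (x : Fin n) → x ∉ˢ p → ∣ p ∪ ⁅ x ⁆ ∣ ≡ suc ∣ p ∣
∣p∪⁅x⁆∣≡1+∣p∣ (inside ∷ p)  fzero    x∉ = contradiction here x∉
∣p∪⁅x⁆∣≡1+∣p∣ (outside ∷ p) fzero    x∉ = cong (suc ∘ ∣_∣) (∪-identityʳ p)
∣p∪⁅x⁆∣≡1+∣p∣ (inside ∷ p)  (fsuc x) x∉ = cong suc (∣p∪⁅x⁆∣≡1+∣p∣ p x (x∉ ∘ there))
∣p∪⁅x⁆∣≡1+∣p∣ (outside ∷ p) (fsuc x) x∉ = ∣p∪⁅x⁆∣≡1+∣p∣ p x (x∉ ∘ there)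

x∈p⇒1+∣p-x∣≡∣p∣ : (p : Subset n) (x : Fin n) → x ∈ˢ p → suc ∣ p - x ∣ ≡ ∣ p ∣
x∈p⇒1+∣p-x∣≡∣p∣ (inside ∷ p)  fzero    here       = cong (suc ∘ ∣_∣) (p─⊥≡p p)
x∈p⇒1+∣p-x∣≡∣p∣ (inside ∷ p)  (fsuc x) (there x∈) = cong suc (x∈p⇒1+∣p-x∣≡∣p∣ p x x∈)
x∈p⇒1+∣p-x∣≡∣p∣ (outside ∷ p) (fsuc x) (there x∈) = x∈p⇒1+∣p-x∣≡∣p∣ p x x∈

x∈p-y⇒x∈p : {x : Fin n} (p : Subset n) (y : Fin n) → x ∈ˢ p - y → x ∈ˢ p
x∈p-y⇒x∈p p y = p─q⊆p p ⁅ y ⁆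

x∉p-x : (p : Subset n) (x : Fin n) → x ∉ˢ p - x
x∉p-x (s ∷ p) (fsuc x) (there h) = x∉p-x p x h

x∈p-y⇒x≢y : {x : Fin n} (p : Subset n) (y : Fin n) → x ∈ˢ p - y → x ≢ y
x∈p-y⇒x≢y p y x∈ refl = x∉p-x p y x∈

∣p∣<∣q∣⇒∃ : (p q : Subset n) → ∣ p ∣ < ∣ q ∣ → ∃ λ x → x ∈ˢ q × x ∉ˢ p
∣p∣<∣q∣⇒∃ p q lt with Finₚ.any? (λ x → (x ∈? q) ×-dec ¬? (x ∈? p))
... | yes h = h
... | no ¬h = contradiction lt (≤⇒≯ (p⊆q⇒∣p∣≤∣q∣ sub))
  where
  sub : q ⊆ˢ p
  sub {x} x∈ with x ∈? p
  ... | yes h = h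
  ... | no n = contradiction (x , x∈ , n) ¬h

⊆∧∣≥∣⇒≡ : {p q : Subset n} → p ⊆ˢ q → ∣ q ∣ ≤ ∣ p ∣ → p ≡ q
⊆∧∣≥∣⇒≡ {p = p} {q} sub le = ⊆-antisym sub back
  where
  back : q ⊆ˢ p
  back {x} x∈ with x ∈? p
  ... | yes h = h
  ... | no n = contradiction le (<⇒≱ (p⊂q⇒∣p∣<∣q∣ (sub , x , x∈ , n)))

p∪⁅x⁆⊆q : {p q : Subset n} {x : Fin n} → p ⊆ˢ q → x ∈ˢ q → p ∪ ⁅ x ⁆ ⊆ˢ q
p∪⁅x⁆⊆q {p = p} {q} {x} sub x∈ {y} y∈ with x∈p∪q⁻ p ⁅ x ⁆ y∈
... | inj₁ h = sub h
... | inj₂ h = subst (_∈ˢ q) (sym (x∈⁅y⁆⇒x≡y x h)) x∈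

⊆∧∣∣≡1+⇒∪ : {p q : Subset n} → p ⊆ˢ q → ∣ q ∣ ≡ suc ∣ p ∣ → ∃ λ x → x ∉ˢ p × q ≡ p ∪ ⁅ x ⁆
⊆∧∣∣≡1+⇒∪ {p = p} {q} sub eq with ∣p∣<∣q∣⇒∃ p q (≤-reflexive (sym eq))
... | x , x∈ , x∉ = x , x∉ ,
  sym (⊆∧∣≥∣⇒≡ (p∪⁅x⁆⊆q sub x∈) (≤-reflexive (trans eq (sym (∣p∪⁅x⁆∣≡1+∣p∣ p x x∉)))))

elements : Subset n → List (Fin n)
elements [] = []
elements (inside ∷ p)  = fzero ∷ map fsuc (elements p)
elements (outside ∷ p) = map fsuc (elements p)

length-elements : (p : Subset n) → length (elements p) ≡ ∣ p ∣
length-elements [] = refl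
length-elements (inside ∷ p)  = cong suc (trans (length-map fsuc (elements p)) (length-elements p))
length-elements (outside ∷ p) = trans (length-map fsuc (elements p)) (length-elements p)

∈-elements⁺ : {p : Subset n} {x : Fin n} → x ∈ˢ p → x ∈ elements p
∈-elements⁺ {p = inside ∷ p}  here = Any.here refl
∈-elements⁺ {p = inside ∷ p}  (there h) = Any.there (∈-map⁺ fsuc (∈-elements⁺ h))
∈-elements⁺ {p = outside ∷ p} (there h) = ∈-map⁺ fsuc (∈-elements⁺ h)

∈-elements⁻ : (p : Subset n) {x : Fin n} → x ∈ elements p → x ∈ˢ p
∈-elements⁻ (inside ∷ p) (Any.here refl) = here
∈-elements⁻ (inside ∷ p) (Any.there h) with ∈-map⁻ fsuc h
... | y , y∈ , refl = there (∈-elements⁻ p y∈)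
∈-elements⁻ (outside ∷ p) h with ∈-map⁻ fsuc h
... | y , y∈ , refl = there (∈-elements⁻ p y∈)

elements-unique : (p : Subset n) → Unique (elements p)
elements-unique [] = []
elements-unique (inside ∷ p) =
  All.tabulate (λ h eq → zero∉ (subst (_∈ _) (sym eq) h)) ∷ Uniqueₚ.map⁺ Finₚ.suc-injective (elements-unique p)
  where
  zero∉ : fzero ∈ map fsuc (elements p) → ⊥
  zero∉ h with ∈-map⁻ fsuc h
  ... | _ , _ , ()
elements-unique (outside ∷ p) = Uniqueₚ.map⁺ Finₚ.suc-injective (elements-unique p)

length-allFin : ∀ n → length (allFin n) ≡ n
length-allFin n = length-tabulate {n = n} (λ i → i)

Unique∧const⇒length≤1 : {A : Set} {xs : List A} (a : A) → Unique xs → (∀ {x} → x ∈ xs → x ≡ a) → length xs ≤ 1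
Unique∧const⇒length≤1 a u h = Unique-⊆⇒length≤ {ys = a ∷ []} u (λ x∈ → Any.here (h x∈))

-- A superset with `suc r` further elements contains one of at most `n` vertices `z` outside `p`,
-- and is then a superset of `p ∪ ⁅ z ⁆` with only `r` further elements.
#-supersets : (r : ℕ) (p : Subset n) (xs : List (Subset n)) → Unique xs →
  (∀ {q} → q ∈ xs → p ⊆ˢ q × ∣ q ∣ ≡ r + ∣ p ∣) → length xs ≤ n ^ r
#-supersets zero p xs u h = Unique∧const⇒length≤1 p u
  λ q∈ → sym (⊆∧∣≥∣⇒≡ (proj₁ (h q∈)) (≤-reflexive (proj₂ (h q∈))))
#-supersets {n} (suc r) p xs u h =
  subst (λ m → length xs ≤ m * n ^ r) (length-allFin n)
    (union-bound R? xs (allFin n) (n ^ r) cov bd)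
  where
  R? : ∀ z q → Dec ((z ∈ˢ q) × (z ∉ˢ p))
  R? z q = (z ∈? q) ×-dec ¬? (z ∈? p)
  cov : ∀ {q} → q ∈ xs → ∃ λ z → z ∈ allFin n × z ∈ˢ q × z ∉ˢ p
  cov {q} q∈ with ∣p∣<∣q∣⇒∃ p q (subst (suc ∣ p ∣ ≤_) (sym (proj₂ (h q∈))) (s≤s (m≤n+m _ r)))
  ... | z , z∈ , z∉ = z , ∈-allFin z , z∈ , z∉
  bd : ∀ {z} → z ∈ allFin n → # (R? z) xs ≤ n ^ r
  bd {z} _ = bound (z ∈? p)
   where
   bound : Dec (z ∈ˢ p) → # (R? z) xs ≤ n ^ r
   bound (yes z∈p) = ≤-trans (≮⇒≥ λ pos → proj₂ (proj₂ (proj₂ (#>0⇒∃ (R? z) xs pos))) z∈p) z≤n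
   bound (no z∉p) = #-supersets r (p ∪ ⁅ z ⁆) (filter (R? z) xs) (Uniqueₚ.filter⁺ (R? z) u) h′
    where
    h′ : ∀ {q} → q ∈ filter (R? z) xs → p ∪ ⁅ z ⁆ ⊆ˢ q × ∣ q ∣ ≡ r + ∣ p ∪ ⁅ z ⁆ ∣
    h′ q∈ with ∈-filter⁻ (R? z) {xs = xs} q∈
    ... | q∈xs , z∈q , _ = p∪⁅x⁆⊆q (proj₁ (h q∈xs)) z∈q ,
      trans (proj₂ (h q∈xs)) (trans (sym (+-suc r _)) (cong (r +_) (sym (∣p∪⁅x⁆∣≡1+∣p∣ p z z∉p))))

-- Sets of given size, and binomial coefficients compared with powers.

subsetsOfSize : (n q : ℕ) → List (Subset n)
subsetsOfSize n       zero    = ∅ ∷ []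
subsetsOfSize zero    (suc q) = []
subsetsOfSize (suc n) (suc q) = map (inside ∷_) (subsetsOfSize n q) ++ map (outside ∷_) (subsetsOfSize n (suc q))

nC0≡1 : ∀ n → n C 0 ≡ 1
nC0≡1 n = trans (nCk≡nC[n∸k] {k = 0} {n = n} z≤n) (nCn≡1 n)

length-subsetsOfSize : ∀ n q → length (subsetsOfSize n q) ≡ n C q
length-subsetsOfSize n zero = sym (nC0≡1 n)
length-subsetsOfSize zero (suc q) = refl
length-subsetsOfSize (suc n) (suc q) = begin
  length (map (inside ∷_) (subsetsOfSize n q) ++ map (outside ∷_) (subsetsOfSize n (suc q)))
    ≡⟨ length-++ (map (inside ∷_) (subsetsOfSize n q)) ⟩
  length (map (inside ∷_) (subsetsOfSize n q)) + length (map (outside ∷_) (subsetsOfSize n (suc q)))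
    ≡⟨ cong₂ _+_ (length-map _ (subsetsOfSize n q)) (length-map _ (subsetsOfSize n (suc q))) ⟩
  length (subsetsOfSize n q) + length (subsetsOfSize n (suc q))
    ≡⟨ cong₂ _+_ (length-subsetsOfSize n q) (length-subsetsOfSize n (suc q)) ⟩
  n C q + n C suc q
    ≡⟨ nCk+nC[k+1]≡[n+1]C[k+1] n q ⟩
  suc n C suc q ∎
  where open ≡-Reasoning

map-∷-disjoint : {xs ys : List (Subset n)} {x : Subset (suc n)} →
  x ∈ map (inside ∷_) xs → x ∈ map (outside ∷_) ys → ⊥
map-∷-disjoint h k with ∈-map⁻ (inside ∷_) h | ∈-map⁻ (outside ∷_) k
... | _ , _ , refl | _ , _ , ()

subsetsOfSize-unique : ∀ n q → Unique (subsetsOfSize n q)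
subsetsOfSize-unique n zero = [] ∷ []
subsetsOfSize-unique zero (suc q) = []
subsetsOfSize-unique (suc n) (suc q) = Uniqueₚ.++⁺
  (Uniqueₚ.map⁺ Vecₚ.∷-injectiveʳ (subsetsOfSize-unique n q))
  (Uniqueₚ.map⁺ Vecₚ.∷-injectiveʳ (subsetsOfSize-unique n (suc q)))
  λ (h , k) → map-∷-disjoint h k

∈-subsetsOfSize⁻ : ∀ q {p : Subset n} → p ∈ subsetsOfSize n q → ∣ p ∣ ≡ q
∈-subsetsOfSize⁻ {n} zero (Any.here refl) = ∣⊥∣≡0 n
∈-subsetsOfSize⁻ {suc n} (suc q) h with ∈-++⁻ (map (inside ∷_) (subsetsOfSize n q)) h
... | inj₁ h′ with ∈-map⁻ (inside ∷_) h′
...   | _ , k , refl = cong suc (∈-subsetsOfSize⁻ q k)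
∈-subsetsOfSize⁻ {suc n} (suc q) h | inj₂ h′ with ∈-map⁻ (outside ∷_) h′
...   | _ , k , refl = ∈-subsetsOfSize⁻ (suc q) k

∈-subsetsOfSize⁺ : (p : Subset n) (q : ℕ) → ∣ p ∣ ≡ q → p ∈ subsetsOfSize n q
∈-subsetsOfSize⁺ [] zero eq = Any.here refl
∈-subsetsOfSize⁺ (inside ∷ p) (suc q) eq = ∈-++⁺ˡ (∈-map⁺ (inside ∷_) (∈-subsetsOfSize⁺ p q (suc-injective eq)))
∈-subsetsOfSize⁺ {suc n} (outside ∷ p) zero eq = Any.here (⊥-unique eq)
  where
  ⊥-unique : ∀ {m} {p : Subset m} → ∣ p ∣ ≡ 0 → p ≡ ∅
  ⊥-unique {m} e = sym (⊆∧∣≥∣⇒≡ (⊆-min _) (≤-trans (≤-reflexive e) z≤n))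
∈-subsetsOfSize⁺ {suc n} (outside ∷ p) (suc q) eq =
  ∈-++⁺ʳ (map (inside ∷_) (subsetsOfSize n q)) (∈-map⁺ (outside ∷_) (∈-subsetsOfSize⁺ p (suc q) eq))

nCq≤n^q : ∀ n q → n C q ≤ n ^ q
nCq≤n^q n q = subst (_≤ n ^ q) (length-subsetsOfSize n q)
  (#-supersets q ∅ (subsetsOfSize n q) (subsetsOfSize-unique n q)
    λ p∈ → ⊆-min _ , trans (∈-subsetsOfSize⁻ q p∈) (trans (sym (+-identityʳ q)) (cong (q +_) (sym (∣⊥∣≡0 n)))))

absorption : ∀ n q → suc q * (suc n C suc q) ≡ suc n * (n C q)
absorption zero zero = refl
absorption zero (suc q) = trans (*-zeroʳ q) refl
absorption (suc n) zero = begin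
  1 * (suc (suc n) C 1)   ≡⟨ *-identityˡ _ ⟩
  suc (suc n) C 1         ≡⟨ nC1≡n (suc (suc n)) ⟩
  suc (suc n)             ≡⟨ *-identityʳ _ ⟨
  suc (suc n) * 1         ≡⟨ cong (suc (suc n) *_) (nC0≡1 (suc n)) ⟨
  suc (suc n) * (suc n C 0) ∎
  where open ≡-Reasoning
absorption (suc n) (suc q) = begin
  suc (suc q) * (suc (suc n) C suc (suc q))
    ≡⟨ cong (suc (suc q) *_) (nCk+nC[k+1]≡[n+1]C[k+1] (suc n) (suc q)) ⟨
  suc (suc q) * (suc n C suc q + suc n C suc (suc q))
    ≡⟨ expand (suc q) (suc n C suc q) (suc n C suc (suc q)) ⟩
  suc n C suc q + (suc q * (suc n C suc q) + suc (suc q) * (suc n C suc (suc q)))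
    ≡⟨ cong (suc n C suc q +_) (cong₂ _+_ (absorption n q) (absorption n (suc q))) ⟩
  suc n C suc q + (suc n * (n C q) + suc n * (n C suc q))
    ≡⟨ cong (suc n C suc q +_) (*-distribˡ-+ (suc n) (n C q) (n C suc q)) ⟨
  suc n C suc q + suc n * (n C q + n C suc q)
    ≡⟨ cong (λ z → suc n C suc q + suc n * z) (nCk+nC[k+1]≡[n+1]C[k+1] n q) ⟩
  suc (suc n) * (suc n C suc q) ∎
  where
  open ≡-Reasoning
  expand : ∀ a b c → suc a * (b + c) ≡ b + (a * b + suc a * c)
  expand = solve-∀

-- A constant with `n ^ q ≤ c[ q ] * (n C q)` for all `n ≥ q`. Passing from `q` to `suc q` costs
-- `2 ^ q` for replacing `suc n ^ q` by `n ^ q`, and `suc q` for `absorption`.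
c[_] : ℕ → ℕ
c[ zero ] = 1
c[ suc q ] = 2 ^ q * c[ q ] * suc q

[1+n]^q≤2^q*n^q : ∀ n q → q ≤ n → suc n ^ q ≤ 2 ^ q * n ^ q
[1+n]^q≤2^q*n^q n zero le = ≤-refl
[1+n]^q≤2^q*n^q (suc n) (suc q) le = begin
  suc (suc n) * suc (suc n) ^ q            ≤⟨ *-mono-≤ (dbl n) ([1+n]^q≤2^q*n^q (suc n) q (≤-trans (n≤1+n q) le)) ⟩
  (2 * suc n) * (2 ^ q * suc n ^ q)        ≡⟨ rearr (suc n) (2 ^ q) (suc n ^ q) ⟩
  2 * 2 ^ q * (suc n * suc n ^ q)          ∎
  where
  open ≤-Reasoning
  rearr : ∀ a b c → (2 * a) * (b * c) ≡ 2 * b * (a * c)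
  rearr = solve-∀
  dbl : ∀ n → suc (suc n) ≤ 2 * suc n
  dbl n = ≤-trans (s≤s (s≤s (m≤m+n n n))) (≤-reflexive (eq n))
    where eq : ∀ n → suc (suc (n + n)) ≡ 2 * suc n
          eq = solve-∀

n^q≤c*nCq : ∀ n q → q ≤ n → n ^ q ≤ c[ q ] * (n C q)
n^q≤c*nCq n zero le = ≤-reflexive (sym (trans (*-identityˡ _) (nC0≡1 n)))
n^q≤c*nCq (suc n) (suc q) (s≤s le) = begin
  suc n * suc n ^ q                        ≤⟨ *-monoʳ-≤ (suc n) ([1+n]^q≤2^q*n^q n q le) ⟩
  suc n * (2 ^ q * n ^ q)                  ≤⟨ *-monoʳ-≤ (suc n) (*-monoʳ-≤ (2 ^ q) (n^q≤c*nCq n q le)) ⟩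
  suc n * (2 ^ q * (c[ q ] * (n C q)))     ≡⟨ r₁ (suc n) (2 ^ q) c[ q ] (n C q) ⟩
  2 ^ q * c[ q ] * (suc n * (n C q))       ≡⟨ cong (2 ^ q * c[ q ] *_) (absorption n q) ⟨
  2 ^ q * c[ q ] * (suc q * (suc n C suc q)) ≡⟨ *-assoc (2 ^ q * c[ q ]) (suc q) _ ⟨
  2 ^ q * c[ q ] * suc q * (suc n C suc q) ∎
  where
  open ≤-Reasoning
  r₁ : ∀ a b c d → a * (b * (c * d)) ≡ b * c * (a * d)
  r₁ = solve-∀

-- Forests: every nonempty set of edges has a leaf.

module _ (T : Graph) where

  end : Bool → Fin (e T) → Fin (V T)
  end false i = proj₁ (lookup (E T) i)
  end true  i = proj₂ (lookup (E T) i)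

  End : Fin (e T) → Fin (V T) → Set
  End i v = (v ≡ end false i) ⊎ (v ≡ end true i)

  End? : ∀ i v → Dec (End i v)
  End? i v = (v Finₚ.≟ end false i) ⊎-dec (v Finₚ.≟ end true i)

  end<end : ∀ i → toℕ (end false i) < toℕ (end true i)
  end<end i = All.lookup (ordered T) (∈-lookup i)

  end≢end : ∀ i → end false i ≢ end true i
  end≢end i eq = <⇒≢ (end<end i) (cong toℕ eq)

  end-not≢end : ∀ b i → end (not b) i ≢ end b i
  end-not≢end true  i = end≢end i
  end-not≢end false i = end≢end i ∘ sym

  End-end : ∀ b i → End i (end b i)
  End-end false i = inj₁ refl
  End-end true  i = inj₂ refl

  End-split : ∀ b i {v} → End i v → v ≡ end b i ⊎ v ≡ end (not b) i
  End-split false i h = h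
  End-split true  i (inj₁ p) = inj₂ p
  End-split true  i (inj₂ p) = inj₁ p

  Adj-end : ∀ b i → Adj T (end (not b) i) (end b i)
  Adj-end true  i = inj₁ (∈-lookup i)
  Adj-end false i = inj₂ (∈-lookup i)

  -- Edges are listed as increasing pairs, so two of them cannot have the same ends in opposite
  -- orders; for equal orders the list has no duplicates.
  edge-unique : ∀ b c {i j} → end b i ≡ end c j → end (not b) i ≡ end (not c) j → i ≡ j
  edge-unique false false p q = lookup-injective (unique T) (cong₂ _,_ p q)
  edge-unique true  true  p q = lookup-injective (unique T) (cong₂ _,_ q p)
  edge-unique false true {i} {j} p q = contradiction
    (<-trans (end<end i) (subst₂ _<_ (cong toℕ (sym q)) (cong toℕ (sym p)) (end<end j))) (n≮n _)
  edge-unique true false {i} {j} p q = contradiction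
    (<-trans (end<end i) (subst₂ _<_ (cong toℕ (sym p)) (cong toℕ (sym q)) (end<end j))) (n≮n _)

  module NonBacktrackingWalk (v : ℕ → Fin (V T))
           (adj : ∀ a → Adj T (v a) (v (suc a)))
           (≢₁ : ∀ a → v a ≢ v (suc a)) (≢₂ : ∀ a → v a ≢ v (suc (suc a))) where

    -- A closed stretch of one or two steps is excluded by `≢₁` and `≢₂`. A longer one either
    -- repeats a vertex inside, which gives a shorter closed stretch, or is itself a cycle of length
    -- `3 + l`.
    closed⇒cycle : ∀ fuel g a → g ≤ fuel → v a ≡ v (a + suc g) → Cycle T
    closed⇒cycle fuel zero a le eq = contradiction (trans eq (cong v (+-comm a 1))) (≢₁ a)
    closed⇒cycle fuel (suc zero) a le eq = contradiction (trans eq (cong v (+-comm a 2))) (≢₂ a)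
    closed⇒cycle (suc fuel) (suc (suc l)) a le eq
      with Finₚ.any? {n = 3 + l} (λ x → Finₚ.any? {n = 3 + l} λ y →
             (toℕ x <? toℕ y) ×-dec (v (a + toℕ x) Finₚ.≟ v (a + toℕ y)))
    ... | yes (x , y , x<y , eq′) with m≤n⇒∃[o]m+o≡n x<y
    ...   | o , o-eq = closed⇒cycle fuel o (a + toℕ x) o≤ (trans eq′ (cong v shift))
      where
      shift : a + toℕ y ≡ a + toℕ x + suc o
      shift = trans (cong (a +_) (trans (sym o-eq) (sym (+-suc (toℕ x) o)))) (sym (+-assoc a (toℕ x) (suc o)))
      o≤ : o ≤ fuel
      o≤ = ≤-pred (≤-trans (≤-trans (s≤s (m≤n+m o (toℕ x))) (≤-trans (≤-reflexive o-eq) (≤-pred (Finₚ.toℕ<n y)))) le)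
    closed⇒cycle (suc fuel) (suc (suc l)) a le eq | no ¬rep = record
      { l = l
      ; c = λ x → v (a + toℕ x)
      ; inj = inj
      ; step = λ i → subst₂ (λ p q → Adj T (v p) (v q))
                       (cong (a +_) (sym (Finₚ.toℕ-inject₁ i))) (sym (+-suc a (toℕ i))) (adj (a + toℕ i))
      ; close = subst₂ (λ p q → Adj T (v p) q) (cong (a +_) (sym (Finₚ.toℕ-fromℕ (2 + l))))
                  (trans (cong v (sym (+-suc a (2 + l)))) (trans (sym eq) (cong v (sym (+-identityʳ a)))))
                  (adj (a + (2 + l)))
      }
      where
      inj : ∀ {x y : Fin (3 + l)} → v (a + toℕ x) ≡ v (a + toℕ y) → x ≡ y
      inj {x} {y} p with <-cmp (toℕ x) (toℕ y)
      ... | tri< lt _ _ = contradiction (x , y , lt , p) ¬rep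
      ... | tri≈ _ q _ = Finₚ.toℕ-injective q
      ... | tri> _ _ gt = contradiction (y , x , gt , sym p) ¬rep

    cycle : Cycle T
    cycle with Finₚ.pigeonhole (n<1+n (V T)) (λ i → v (toℕ i))
    ... | i , j , i<j , eq with m≤n⇒∃[o]m+o≡n i<j
    ... | o , o-eq = closed⇒cycle o o (toℕ i) ≤-refl
      (trans eq (cong v (trans (sym o-eq) (sym (+-suc (toℕ i) o)))))

  record Leaf (S : Subset (e T)) : Set where
    field
      edge  : Fin (e T)
      side  : Bool
      edge∈ : edge ∈ˢ S
      leaf  : ∀ j → j ∈ˢ S → j ≢ edge → ¬ End j (end side edge)

  -- Without a leaf, an edge of `S` traversed in either direction can be continued by a different
  -- edge of `S`. This gives an infinite walk without backtracking, and such a walk contains a cycle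
  -- by finiteness.
  forest⇒leaf : IsForest T → (S : Subset (e T)) → Nonempty S → Leaf S
  forest⇒leaf forest S (i₀ , i₀∈)
    with Finₚ.any? (λ i → (i ∈? S) ×-dec (¬? (next? i false) ⊎-dec ¬? (next? i true)))
    where
    next? : ∀ i b → Dec (∃ λ j → j ∈ˢ S × j ≢ i × End j (end b i))
    next? i b = Finₚ.any? λ j → (j ∈? S) ×-dec ¬? (j Finₚ.≟ i) ×-dec End? j (end b i)
  ... | yes (i , i∈ , inj₁ ¬nx) = record { edge = i ; side = false ; edge∈ = i∈ ; leaf = λ j j∈ j≢ en → ¬nx (j , j∈ , j≢ , en) }
  ... | yes (i , i∈ , inj₂ ¬nx) = record { edge = i ; side = true  ; edge∈ = i∈ ; leaf = λ j j∈ j≢ en → ¬nx (j , j∈ , j≢ , en) }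
  ... | no ¬leaf = ⊥-elim (forest (NonBacktrackingWalk.cycle tail adj ≢₁ ≢₂))
    where
    record State : Set where
      constructor st
      field
        at  : Fin (e T)
        dir : Bool
        in-S : at ∈ˢ S
    open State
    head′ tail′ : State → Fin (V T)
    head′ s = end (dir s) (at s)
    tail′ s = end (not (dir s)) (at s)
    next : ∀ i b → i ∈ˢ S → ∃ λ j → j ∈ˢ S × j ≢ i × End j (end b i)
    next i b i∈ with Finₚ.any? (λ j → (j ∈? S) ×-dec ¬? (j Finₚ.≟ i) ×-dec End? j (end b i))
    ... | yes h = h
    next i false i∈ | no ¬h = contradiction (i , i∈ , inj₁ ¬h) ¬leaf
    next i true  i∈ | no ¬h = contradiction (i , i∈ , inj₂ ¬h) ¬leaf
    adv : (s : State) → Σ State λ s′ → tail′ s′ ≡ head′ s × at s′ ≢ at s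
    adv s with next (at s) (dir s) (in-S s)
    ... | j , j∈ , j≢ , inj₁ p = st j true j∈ , sym p , j≢
    ... | j , j∈ , j≢ , inj₂ p = st j false j∈ , sym p , j≢
    walk : ℕ → State
    walk zero = st i₀ true i₀∈
    walk (suc a) = proj₁ (adv (walk a))
    tail : ℕ → Fin (V T)
    tail a = tail′ (walk a)
    link : ∀ a → tail (suc a) ≡ head′ (walk a)
    link a = proj₁ (proj₂ (adv (walk a)))
    adj : ∀ a → Adj T (tail a) (tail (suc a))
    adj a = subst (Adj T (tail a)) (sym (link a)) (Adj-end (dir (walk a)) (at (walk a)))
    ≢₁ : ∀ a → tail a ≢ tail (suc a)
    ≢₁ a eq = end-not≢end (dir (walk a)) (at (walk a)) (trans eq (link a))
    not-not : ∀ b → not (not b) ≡ b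
    not-not false = refl
    not-not true = refl
    -- Returning after two steps would mean that two consecutive edges have the same ends, whereas
    -- `adv` chooses a different edge.
    ≢₂ : ∀ a → tail a ≢ tail (suc (suc a))
    ≢₂ a eq = proj₂ (proj₂ (adv (walk a)))
      (edge-unique (dir s′) (not (dir s)) {at s′} {at s}
        (trans (sym (link (suc a))) (sym eq))
        (trans (link a) (cong (λ b → end b (at s)) (sym (not-not (dir s))))))
      where s = walk a
            s′ = walk (suc a)

-- The greedy embedding of a forest, leaf by leaf.

update : {m : ℕ} {A : Set} → (Fin m → A) → Fin m → A → Fin m → A
update f w a v with v Finₚ.≟ w
... | yes _ = a
... | no  _ = f v

update-≢ : {m : ℕ} {A : Set} (f : Fin m → A) {w v : Fin m} (a : A) → v ≢ w → update f w a v ≡ f v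
update-≢ f {w} {v} a v≢ with v Finₚ.≟ w
... | yes p = contradiction p v≢
... | no _  = refl

length-concatMap-≤ : {A B : Set} (f : A → List B) (K : ℕ) (xs : List A) → (∀ x → length (f x) ≤ K) →
  length (concatMap f xs) ≤ length xs * K
length-concatMap-≤ f K [] h = z≤n
length-concatMap-≤ f K (x ∷ xs) h = ≤-trans (≤-reflexive (length-++ (f x)))
  (+-mono-≤ (h x) (length-concatMap-≤ f K xs h))

-- `P` marks the vertices at which a new set can be attached. Each new set carries a second such
-- vertex, to which the other end of a graph edge can be sent, so that the process never gets stuck
-- while at most `κ` vertices are to be avoided.
record Spread {n : ℕ} (κ : ℕ) (Mem : Subset n → Set) (P : Fin n → Set) : Set where
  field
    root   : ∃ P
    extend : ∀ y → P y → (us : List (Fin n)) → length us ≤ κ →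
             Σ (Subset n) λ D → Mem D × y ∈ˢ D × (∀ {z} → z ∈ˢ D → z ≢ y → z ∉ us) ×
               ∃ λ y′ → y′ ∈ˢ D × y′ ≢ y × P y′

module Greedy {n : ℕ} (T : Graph) (forest : IsForest T)
  (X : Subset (V T)) (indep : ∀ i → end T false i ∈ˢ X → end T true i ∉ˢ X)
  (Mem : Subset n → Set) (P : Fin n → Set) (K κ : ℕ) (us₀ : List (Fin n))
  (κ-large : V T + (e T * K + length us₀) ≤ κ) (Mem-small : ∀ {D} → Mem D → ∣ D ∣ ≤ K)
  (spread : Spread κ Mem P) where

  open Spread spread

  -- Only the edges in `S` are embedded, yet `φ` is injective on all vertices: those not reached so
  -- far have placeholder images, which satisfy `P` so that sets can be attached there. By `inc⁻`
  -- the images of vertices of `X` lie in no set, hence they can later be replaced by the constants.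
  record Embedding (S : Subset (e T)) : Set where
    field
      φ      : Fin (V T) → Fin n
      D      : Fin (e T) → Subset n
      φ-inj  : ∀ {v w} → φ v ≡ φ w → v ≡ w
      φ-P    : ∀ v → P (φ v)
      φ-us₀  : ∀ v → φ v ∉ us₀
      -- Asked for every `i`, as the list of used vertices ranges over the sets of all edges.
      small  : ∀ i → ∣ D i ∣ ≤ K
      mem    : ∀ {i} → i ∈ˢ S → Mem (D i)
      D-us₀  : ∀ {i z} → i ∈ˢ S → z ∈ˢ D i → z ∉ us₀
      inc⁺   : ∀ {i v} → i ∈ˢ S → End T i v → v ∉ˢ X → φ v ∈ˢ D i
      inc⁻   : ∀ {i v} → i ∈ˢ S → φ v ∈ˢ D i → End T i v × v ∉ˢ X
      meet   : ∀ {i j z} → i ∈ˢ S → j ∈ˢ S → i ≢ j → z ∈ˢ D i → z ∈ˢ D j → ∃ λ v → z ≡ φ v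

  -- Each further image is the second `P`-vertex of a set attached at the root and avoiding `us₀`
  -- and all earlier images.
  place : (v : ℕ) → v ≤ V T → Σ (Fin v → Fin n) λ φ →
          (∀ {x y} → φ x ≡ φ y → x ≡ y) × (∀ x → P (φ x)) × (∀ x → φ x ∉ us₀)
  place zero le = (λ ()) , (λ { {()} }) , (λ ()) , λ ()
  place (suc v) le with place v (≤-trans (n≤1+n v) le)
  ... | φ , inj , p , u
    with extend (proj₁ root) (proj₂ root) (map φ (allFin v) ++ us₀)
           (≤-trans (≤-reflexive (trans (length-++ (map φ (allFin v)))
              (cong (_+ length us₀) (trans (length-map φ (allFin v)) (length-allFin v)))))
            (≤-trans (+-mono-≤ (≤-trans (n≤1+n v) le) (m≤n+m (length us₀) (e T * K))) κ-large))
  ... | D , _ , _ , av , y , y∈ , y≢ , py = φ′ , inj′ , p′ , u′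
    where
    y∉ : y ∉ map φ (allFin v) ++ us₀
    y∉ = av y∈ y≢
    φ′ : Fin (suc v) → Fin n
    φ′ fzero = y
    φ′ (fsuc x) = φ x
    im : ∀ x → φ x ∈ map φ (allFin v) ++ us₀
    im x = ∈-++⁺ˡ (∈-map⁺ φ (∈-allFin x))
    inj′ : ∀ {x y} → φ′ x ≡ φ′ y → x ≡ y
    inj′ {fzero} {fzero} _ = refl
    inj′ {fzero} {fsuc b} eq = contradiction (subst (_∈ _) (sym eq) (im b)) y∉
    inj′ {fsuc a} {fzero} eq = contradiction (subst (_∈ _) eq (im a)) y∉
    inj′ {fsuc a} {fsuc b} eq = cong fsuc (inj eq)
    p′ : ∀ x → P (φ′ x)
    p′ fzero = py
    p′ (fsuc x) = p x
    u′ : ∀ x → φ′ x ∉ us₀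
    u′ fzero h = y∉ (∈-++⁺ʳ (map φ (allFin v)) h)
    u′ (fsuc x) = u x

  empty : ∀ S → ¬ Nonempty S → Embedding S
  empty S ¬ne with place (V T) ≤-refl
  ... | φ , inj , p , u = record
    { φ = φ ; D = λ _ → ∅ ; φ-inj = inj ; φ-P = p ; φ-us₀ = u
    ; small = λ _ → ≤-trans (≤-reflexive (∣⊥∣≡0 n)) z≤n
    ; mem = λ i∈ → contradiction (_ , i∈) ¬ne
    ; D-us₀ = λ i∈ → contradiction (_ , i∈) ¬ne
    ; inc⁺ = λ i∈ → contradiction (_ , i∈) ¬ne
    ; inc⁻ = λ i∈ → contradiction (_ , i∈) ¬ne
    ; meet = λ i∈ → contradiction (_ , i∈) ¬ne }

  module AddEdge {S : Subset (e T)} (i : Fin (e T)) (M : Embedding (S - i)) where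
    open Embedding M

    used : List (Fin n)
    used = map φ (allFin (V T)) ++ (concatMap (elements ∘ D) (allFin (e T)) ++ us₀)

    used-small : length used ≤ κ
    used-small = begin
      length used ≡⟨ length-++ (map φ (allFin (V T))) ⟩
      length (map φ (allFin (V T))) + length (concatMap (elements ∘ D) (allFin (e T)) ++ us₀)
        ≡⟨ cong₂ _+_ (trans (length-map φ (allFin (V T))) (length-allFin (V T))) (length-++ (concatMap (elements ∘ D) (allFin (e T)))) ⟩
      V T + (length (concatMap (elements ∘ D) (allFin (e T))) + length us₀)
        ≤⟨ +-monoʳ-≤ (V T) (+-monoˡ-≤ (length us₀) (≤-trans
            (length-concatMap-≤ (elements ∘ D) K (allFin (e T)) (λ j → ≤-trans (≤-reflexive (length-elements (D j))) (small j)))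
            (≤-reflexive (cong (_* K) (length-allFin (e T)))))) ⟩
      V T + (e T * K + length us₀) ≤⟨ κ-large ⟩
      κ ∎
      where open ≤-Reasoning

    φ∈used : ∀ v → φ v ∈ used
    φ∈used v = ∈-++⁺ˡ (∈-map⁺ φ (∈-allFin v))

    D⊆used : ∀ {j z} → z ∈ˢ D j → z ∈ used
    D⊆used {j} z∈ = ∈-++⁺ʳ (map φ (allFin (V T))) (∈-++⁺ˡ (∈-concatMap⁺ (elements ∘ D) (lose (∈-allFin j) (∈-elements⁺ z∈))))

    us₀⊆used : ∀ {z} → z ∈ us₀ → z ∈ used
    us₀⊆used z∈ = ∈-++⁺ʳ (map φ (allFin (V T))) (∈-++⁺ʳ (concatMap (elements ∘ D) (allFin (e T))) z∈)

    old : ∀ {j} → j ∈ˢ S → j ≢ i → j ∈ˢ S - i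
    old j∈ j≢ = x∈p∧x≢y⇒x∈p-y j∈ j≢

    -- o is the endpoint through which the new set is attached.
    module _ (o : Fin (V T)) (o-end : End T i o) (o∉X : o ∉ˢ X)
             (D₀ : Subset n) (memD₀ : Mem D₀) (o∈ : φ o ∈ˢ D₀)
             (fresh : ∀ {z} → z ∈ˢ D₀ → z ≢ φ o → z ∉ used) where

      D′ : Fin (e T) → Subset n
      D′ = update D i D₀

      small′ : ∀ j → ∣ D′ j ∣ ≤ K
      small′ j with j Finₚ.≟ i
      ... | yes _ = Mem-small memD₀
      ... | no _ = small j

      mem′ : ∀ {j} → j ∈ˢ S → Mem (D′ j)
      mem′ {j} j∈ with j Finₚ.≟ i
      ... | yes _ = memD₀
      ... | no j≢ = mem (old j∈ j≢)

      D₀-us₀ : ∀ {z} → z ∈ˢ D₀ → z ∉ us₀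
      D₀-us₀ {z} z∈ with z Finₚ.≟ φ o
      ... | yes refl = φ-us₀ o
      ... | no z≢ = fresh z∈ z≢ ∘ us₀⊆used

      D-us₀′ : ∀ {j z} → j ∈ˢ S → z ∈ˢ D′ j → z ∉ us₀
      D-us₀′ {j} j∈ with j Finₚ.≟ i
      ... | yes _ = D₀-us₀
      ... | no j≢ = D-us₀ (old j∈ j≢)

      D₀-meet : ∀ {j z} → z ∈ˢ D₀ → z ∈ˢ D j → z ≡ φ o
      D₀-meet {j} {z} z∈ z∈′ with z Finₚ.≟ φ o
      ... | yes p = p
      ... | no z≢ = contradiction (D⊆used z∈′) (fresh z∈ z≢)

      D₀-φ : ∀ {v} → φ v ∈ˢ D₀ → v ≡ o
      D₀-φ {v} v∈ with φ v Finₚ.≟ φ o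
      ... | yes p = φ-inj p
      ... | no z≢ = contradiction (φ∈used v) (fresh v∈ z≢)

      -- For two old sets the common vertex comes with an edge of `S` other than `i` that ends
      -- there; this shows that it is not the leaf that `move` relocates.
      meet′ : ∀ {j l z} → j ∈ˢ S → l ∈ˢ S → j ≢ l → z ∈ˢ D′ j → z ∈ˢ D′ l →
              (z ≡ φ o) ⊎ ∃ λ v → z ≡ φ v × ∃ λ a → a ∈ˢ S × a ≢ i × End T a v
      meet′ {j} {l} j∈ l∈ j≢l with j Finₚ.≟ i | l Finₚ.≟ i
      ... | yes refl | yes refl = contradiction refl j≢l
      ... | yes _ | no _  = λ p q → inj₁ (D₀-meet p q)
      ... | no _  | yes _ = λ p q → inj₁ (D₀-meet q p)
      ... | no j≢ | no l≢ = λ p q → let (v , eq) = meet (old j∈ j≢) (old l∈ l≢) j≢l p q in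
        inj₂ (v , eq , j , j∈ , j≢ , proj₁ (inc⁻ (old j∈ j≢) (subst (_∈ˢ D j) eq p)))

      attach : (∀ {v} → End T i v → v ∉ˢ X → v ≡ o) → Embedding S
      attach only = record
        { φ = φ ; D = D′ ; φ-inj = φ-inj ; φ-P = φ-P ; φ-us₀ = φ-us₀ ; small = small′ ; mem = mem′
        ; D-us₀ = D-us₀′ ; inc⁺ = inc⁺′ ; inc⁻ = inc⁻′
        ; meet = λ j∈ l∈ j≢l p q → [ (λ h → o , h) , (λ (v , h , _) → v , h) ]′ (meet′ j∈ l∈ j≢l p q) }
        where
        inc⁺′ : ∀ {j v} → j ∈ˢ S → End T j v → v ∉ˢ X → φ v ∈ˢ D′ j
        inc⁺′ {j} {v} j∈ en v∉ with j Finₚ.≟ i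
        ... | yes refl = subst (λ w → φ w ∈ˢ D₀) (sym (only en v∉)) o∈
        ... | no j≢ = inc⁺ (old j∈ j≢) en v∉
        inc⁻′ : ∀ {j v} → j ∈ˢ S → φ v ∈ˢ D′ j → End T j v × v ∉ˢ X
        inc⁻′ {j} {v} j∈ with j Finₚ.≟ i
        ... | yes refl = λ h → subst (λ w → End T i w × w ∉ˢ X) (sym (D₀-φ h)) (o-end , o∉X)
        ... | no j≢ = inc⁻ (old j∈ j≢)

      -- Sending `w` to the fresh vertex `y` disturbs no earlier set, because `w` lies on no other
      -- edge of `S` and `y` belongs to no earlier set.
      move : (w : Fin (V T)) → w ≢ o → w ∉ˢ X → End T i w → (∀ {v} → End T i v → v ≡ o ⊎ v ≡ w) →
             (∀ {j} → j ∈ˢ S → j ≢ i → ¬ End T j w) →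
             (y : Fin n) → y ∈ˢ D₀ → y ≢ φ o → P y → Embedding S
      move w w≢o w∉X w-end only lf y y∈ y≢ py = record
        { φ = φ′ ; D = D′ ; φ-inj = inj′ ; φ-P = φ-P′ ; φ-us₀ = φ-us₀′ ; small = small′ ; mem = mem′
        ; D-us₀ = D-us₀′ ; inc⁺ = inc⁺′ ; inc⁻ = inc⁻′
        ; meet = λ j∈ l∈ j≢l p q → [ (λ h → o , trans h (sym (φ′≢ (w≢o ∘ sym)))) , keep ]′ (meet′ j∈ l∈ j≢l p q) }
        where
        φ′ : Fin (V T) → Fin n
        φ′ = update φ w y
        φ′≢ : ∀ {v} → v ≢ w → φ′ v ≡ φ v
        φ′≢ = update-≢ φ y
        y∉ : y ∉ used
        y∉ = fresh y∈ y≢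
        keep : ∀ {z} → (∃ λ v → z ≡ φ v × ∃ λ a → a ∈ˢ S × a ≢ i × End T a v) → ∃ λ v → z ≡ φ′ v
        keep (v , eq , a , a∈ , a≢ , en) = v , trans eq (sym (φ′≢ λ { refl → lf a∈ a≢ en }))
        inj′ : ∀ {a b} → φ′ a ≡ φ′ b → a ≡ b
        inj′ {a} {b} eq with a Finₚ.≟ w | b Finₚ.≟ w
        ... | yes p | yes q = trans p (sym q)
        ... | yes p | no q = contradiction (subst (_∈ used) (sym eq) (φ∈used b)) y∉
        ... | no p | yes q = contradiction (subst (_∈ used) eq (φ∈used a)) y∉
        ... | no p | no q = φ-inj eq
        φ-P′ : ∀ v → P (φ′ v)
        φ-P′ v with v Finₚ.≟ w
        ... | yes _ = py
        ... | no _ = φ-P v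
        φ-us₀′ : ∀ v → φ′ v ∉ us₀
        φ-us₀′ v with v Finₚ.≟ w
        ... | yes _ = y∉ ∘ us₀⊆used
        ... | no _ = φ-us₀ v
        inc⁺′ : ∀ {j v} → j ∈ˢ S → End T j v → v ∉ˢ X → φ′ v ∈ˢ D′ j
        inc⁺′ {j} {v} j∈ en v∉ with j Finₚ.≟ i | v Finₚ.≟ w
        ... | yes refl | yes refl = y∈
        ... | yes refl | no v≢ with only en
        ...   | inj₁ refl = o∈
        ...   | inj₂ p = contradiction p v≢
        inc⁺′ {j} {v} j∈ en v∉ | no j≢ | yes refl = contradiction en (lf j∈ j≢)
        inc⁺′ {j} {v} j∈ en v∉ | no j≢ | no v≢ = inc⁺ (old j∈ j≢) en v∉
        inc⁻′ : ∀ {j v} → j ∈ˢ S → φ′ v ∈ˢ D′ j → End T j v × v ∉ˢ X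
        inc⁻′ {j} {v} j∈ with j Finₚ.≟ i | v Finₚ.≟ w
        ... | yes refl | yes refl = λ _ → w-end , w∉X
        ... | yes refl | no v≢ = λ h → subst (λ w → End T i w × w ∉ˢ X) (sym (D₀-φ h)) (o-end , o∉X)
        ... | no j≢ | yes refl = λ h → contradiction (D⊆used h) y∉
        ... | no j≢ | no v≢ = inc⁻ (old j∈ j≢)

    -- If one end lies in `X`, the new set has to contain the image of the other end only, and is
    -- attached there, be it the leaf or not. If neither does, the set is attached at the inner end
    -- and the leaf is moved into it. Independence rules out the remaining case.
    add : (b : Bool) → i ∈ˢ S → (∀ j → j ∈ˢ S → j ≢ i → ¬ End T j (end T b i)) → Embedding S
    add b i∈ lf with end T b i ∈? X | end T (not b) i ∈? X
    ... | yes p | yes q = ⊥-elim (both b p q)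
      where
      both : ∀ b → end T b i ∈ˢ X → end T (not b) i ∈ˢ X → ⊥
      both false p q = indep i p q
      both true p q = indep i q p
    ... | yes p | no q = go (extend (φ o) (φ-P o) used used-small)
      where
      o = end T (not b) i
      only : ∀ {v} → End T i v → v ∉ˢ X → v ≡ o
      only en v∉ with End-split T b i en
      ... | inj₁ refl = contradiction p v∉
      ... | inj₂ h = h
      go : _ → Embedding S
      go (D₀ , m , o∈ , av , _) = attach o (End-end T (not b) i) q D₀ m o∈ av only
    ... | no p | yes q = go (extend (φ o) (φ-P o) used used-small)
      where
      o = end T b i
      only : ∀ {v} → End T i v → v ∉ˢ X → v ≡ o
      only en v∉ with End-split T b i en
      ... | inj₂ refl = contradiction q v∉
      ... | inj₁ h = h
      go : _ → Embedding S
      go (D₀ , m , o∈ , av , _) = attach o (End-end T b i) p D₀ m o∈ av only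
    ... | no p | no q = go (extend (φ o) (φ-P o) used used-small)
      where
      o = end T (not b) i
      only : ∀ {v} → End T i v → v ≡ o ⊎ v ≡ end T b i
      only en with End-split T b i en
      ... | inj₁ h = inj₂ h
      ... | inj₂ h = inj₁ h
      go : _ → Embedding S
      go (D₀ , m , o∈ , av , y , y∈ , y≢ , py) =
        move o (End-end T (not b) i) q D₀ m o∈ av (end T b i) (end-not≢end T b i ∘ sym) p (End-end T b i)
          only (λ {j} → lf j) y y∈ y≢ py

  embed : (fuel : ℕ) (S : Subset (e T)) → ∣ S ∣ ≤ fuel → Embedding S
  embed fuel S le with nonempty? S
  ... | no ¬ne = empty S ¬ne
  embed zero S le | yes (i , i∈) = contradiction (≤-trans (≤-reflexive (x∈p⇒1+∣p-x∣≡∣p∣ S i i∈)) le) λ ()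
  embed (suc fuel) S le | yes ne = AddEdge.add edge (embed fuel (S - edge)
      (≤-pred (≤-trans (≤-reflexive (x∈p⇒1+∣p-x∣≡∣p∣ S edge edge∈)) le))) side edge∈ leaf
    where open Leaf (forest⇒leaf T forest S ne)

  embedding : Embedding full
  embedding = embed (e T) full (≤-reflexive (∣⊤∣≡n (e T)))

-- From a system of edges to a copy of the expansion.

record SetEmbedding {k n : ℕ} (F : UHypergraph k n) (T : Graph) : Set where
  field
    φ     : Fin (V T) → Fin n
    D     : Fin (e T) → Subset n
    φ-inj : ∀ {v w} → φ v ≡ φ w → v ≡ w
    mem   : ∀ i → D i ∈ edges F
    inc⁺  : ∀ {i v} → End T i v → φ v ∈ˢ D i
    inc⁻  : ∀ {i v} → φ v ∈ˢ D i → End T i v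
    meet  : ∀ {i j z} → i ≢ j → z ∈ˢ D i → z ∈ˢ D j → ∃ λ v → z ≡ φ v

-- Without the images of its two ends, each `D i` has `r` elements, and their enumeration supplies
-- the new vertices. They are not images of vertices of `T`, so by `meet` different edges have
-- different ones.
containsExpansion : {r n : ℕ} {F : UHypergraph (2 + r) n} {T : Graph} → SetEmbedding F T → ContainsExpansion F T
containsExpansion {r} {n} {F} {T} M = Φ , Φ-inj , λ i → D i , mem i , λ z → mk⇔ (to i) (from i)
  where
  open SetEmbedding M
  rest : Fin (e T) → Subset n
  rest i = D i - φ (end T false i) - φ (end T true i)
  ∣rest∣ : ∀ i → length (elements (rest i)) ≡ r
  ∣rest∣ i = trans (length-elements (rest i)) (suc-injective (suc-injective
    (trans (cong suc (x∈p⇒1+∣p-x∣≡∣p∣ _ _ (x∈p∧x≢y⇒x∈p-y (inc⁺ {i} (inj₂ refl)) (end≢end T i ∘ sym ∘ φ-inj))))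
      (trans (x∈p⇒1+∣p-x∣≡∣p∣ _ _ (inc⁺ {i} (inj₁ refl))) (All.lookup (uniform F) (mem i))))))
  rest⇒D : ∀ {i z} → z ∈ˢ rest i → z ∈ˢ D i
  rest⇒D h = x∈p-y⇒x∈p _ _ (x∈p-y⇒x∈p _ _ h)
  rest-φ : ∀ {i v} → φ v ∈ˢ rest i → ⊥
  rest-φ {i} {v} h with inc⁻ {i} {v} (rest⇒D h)
  ... | inj₁ refl = x∈p-y⇒x≢y _ _ (x∈p-y⇒x∈p _ _ h) refl
  ... | inj₂ refl = x∈p-y⇒x≢y _ _ h refl
  ψ : Fin (e T) → Fin r → Fin n
  ψ i j = lookup (elements (rest i)) (cast (sym (∣rest∣ i)) j)
  ψ∈ : ∀ i j → ψ i j ∈ˢ rest i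
  ψ∈ i j = ∈-elements⁻ (rest i) (∈-lookup (cast (sym (∣rest∣ i)) j))
  ψ-inj : ∀ i {j j′} → ψ i j ≡ ψ i j′ → j ≡ j′
  ψ-inj i {j} {j′} eq = Finₚ.toℕ-injective (trans (sym (Finₚ.toℕ-cast (sym (∣rest∣ i)) j))
    (trans (cong toℕ (lookup-injective (elements-unique (rest i)) eq)) (Finₚ.toℕ-cast (sym (∣rest∣ i)) j′)))
  Φ : ExpVertex T (2 + r) → Fin n
  Φ (inj₁ v) = φ v
  Φ (inj₂ (i , j)) = ψ i j
  Φ-inj : ∀ {a b} → Φ a ≡ Φ b → a ≡ b
  Φ-inj {inj₁ v} {inj₁ w} eq = cong inj₁ (φ-inj eq)
  Φ-inj {inj₁ v} {inj₂ (i , j)} eq = ⊥-elim (rest-φ {i} {v} (subst (_∈ˢ rest i) (sym eq) (ψ∈ i j)))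
  Φ-inj {inj₂ (i , j)} {inj₁ v} eq = ⊥-elim (rest-φ {i} {v} (subst (_∈ˢ rest i) eq (ψ∈ i j)))
  Φ-inj {inj₂ (i , j)} {inj₂ (i′ , j′)} eq with i Finₚ.≟ i′
  ... | yes refl = cong (λ x → inj₂ (i , x)) (ψ-inj i eq)
  ... | no i≢ with meet i≢ (rest⇒D (ψ∈ i j)) (subst (_∈ˢ D i′) (sym eq) (rest⇒D (ψ∈ i′ j′)))
  ...   | v , p = ⊥-elim (rest-φ {i} {v} (subst (_∈ˢ rest i) p (ψ∈ i j)))
  to : ∀ i {z} → z ∈ˢ D i → Σ (ExpVertex T (2 + r)) λ w → InExpEdge T (2 + r) i w × Φ w ≡ z
  to i {z} z∈ with z Finₚ.≟ φ (end T false i) | z Finₚ.≟ φ (end T true i)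
  ... | yes p | _ = inj₁ (end T false i) , inj₁ refl , sym p
  ... | no _ | yes q = inj₁ (end T true i) , inj₂ refl , sym q
  ... | no p | no q = inj₂ (i , cast (∣rest∣ i) (index z∈′)) , refl ,
      trans (cong (lookup (elements (rest i))) (Finₚ.toℕ-injective
        (trans (Finₚ.toℕ-cast (sym (∣rest∣ i)) (cast (∣rest∣ i) (index z∈′))) (Finₚ.toℕ-cast (∣rest∣ i) (index z∈′))))) (sym (lookup-index z∈′))
    where
    z∈′ : z ∈ elements (rest i)
    z∈′ = ∈-elements⁺ (x∈p∧x≢y⇒x∈p-y (x∈p∧x≢y⇒x∈p-y z∈ p) q)
  from : ∀ i {z} → (Σ (ExpVertex T (2 + r)) λ w → InExpEdge T (2 + r) i w × Φ w ≡ z) → z ∈ˢ D i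
  from i (inj₁ v , en , refl) = inc⁺ en
  from i (inj₂ (i , j) , refl , refl) = rest⇒D (ψ∈ i j)

-- Sets through given points, and spread families from a full shadow.

#-supersets-filter : {n : ℕ} (r : ℕ) (p : Subset n) {Q : Subset n → Set} (Q? : Decidable Q) {xs : List (Subset n)} →
  Unique xs → (∀ {q} → q ∈ xs → Q q → p ⊆ˢ q × ∣ q ∣ ≡ r + ∣ p ∣) → # Q? xs ≤ n ^ r
#-supersets-filter r p Q? {xs} u h = #-supersets r p (filter Q? xs) (Uniqueₚ.filter⁺ Q? u)
  λ q∈ → let (q∈xs , Qq) = ∈-filter⁻ Q? {xs = xs} q∈ in h q∈xs Qq

#-none : {A : Set} {Q : A → Set} (Q? : Decidable Q) (xs : List A) → (∀ {x} → ¬ Q x) → ∀ {b} → # Q? xs ≤ b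
#-none Q? xs h {b} = ≤-trans (≮⇒≥ λ pos → h (proj₂ (proj₂ (#>0⇒∃ Q? xs pos)))) z≤n

⁅x⁆⊆ : {n : ℕ} {x : Fin n} {p : Subset n} → x ∈ˢ p → ⁅ x ⁆ ⊆ˢ p
⁅x⁆⊆ {x = x} {p} x∈ {z} z∈ = subst (_∈ˢ p) (sym (x∈⁅y⁆⇒x≡y x z∈)) x∈

second-element : {n : ℕ} (p : Subset n) (y : Fin n) → 2 ≤ ∣ p ∣ → ∃ λ z → z ∈ˢ p × z ≢ y
second-element p y le with ∣p∣<∣q∣⇒∃ ⁅ y ⁆ p (subst (_< ∣ p ∣) (sym (∣⁅x⁆∣≡1 y)) le)
... | z , z∈ , z∉ = z , z∈ , x∉⁅y⁆⇒x≢y z∉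

#-through-pair : {n : ℕ} (r : ℕ) {y u : Fin n} → u ≢ y → {xs : List (Subset n)} → Unique xs →
  (∀ {D} → D ∈ xs → ∣ D ∣ ≡ 2 + r) → {Q : Subset n → Set} (Q? : Decidable Q) →
  (∀ {D} → D ∈ xs → Q D → y ∈ˢ D × u ∈ˢ D) → # Q? xs ≤ n ^ r
#-through-pair {n} r {y} {u} u≢y {xs} uq size Q? h = #-supersets-filter r (⁅ y ⁆ ∪ ⁅ u ⁆) Q? uq
  λ D∈ QD → let (y∈ , u∈) = h D∈ QD in p∪⁅x⁆⊆q (⁅x⁆⊆ y∈) u∈ ,
    trans (size D∈) (trans (+-comm 2 r) (cong (r +_) (sym
      (trans (∣p∪⁅x⁆∣≡1+∣p∣ ⁅ y ⁆ u (x≢y⇒x∉⁅y⁆ u≢y)) (cong suc (∣⁅x⁆∣≡1 y))))))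

#-through-point : {n : ℕ} (r : ℕ) (y : Fin n) {xs : List (Subset n)} → Unique xs →
  (∀ {D} → D ∈ xs → ∣ D ∣ ≡ 1 + r) → # (y ∈?_) xs ≤ n ^ r
#-through-point r y uq size = #-supersets-filter r ⁅ y ⁆ (y ∈?_) uq
  λ D∈ y∈ → ⁅x⁆⊆ y∈ , trans (size D∈) (trans (+-comm 1 r) (cong (r +_) (sym (∣⁅x⁆∣≡1 y))))

Spread-mono : {n κ : ℕ} {Mem Mem′ : Subset n → Set} {P : Fin n → Set} →
  (∀ {D} → Mem D → Mem′ D) → Spread κ Mem P → Spread κ Mem′ P
Spread-mono f S = record { root = root ; extend = λ y py us le →
  let (D , m , rest) = extend y py us le in D , f m , rest }
  where open Spread S

module _ (T : Graph) (forest : IsForest T) {r n : ℕ} (F : UHypergraph (2 + r) n) (κ : ℕ)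
         (κ-large : V T + e T * (2 + r) ≤ κ) where

  -- With `X` empty no vertex is exempt: each set contains the images of both ends of its edge, as a
  -- copy of the expansion requires.
  spread⇒expansion : {P : Fin n → Set} → Spread κ (_∈ edges F) P → ContainsExpansion F T
  spread⇒expansion {P} S = containsExpansion {F = F} {T = T} record
    { φ = φ ; D = D ; φ-inj = φ-inj ; mem = λ i → mem ∈⊤
    ; inc⁺ = λ en → inc⁺ ∈⊤ en ∉⊥
    ; inc⁻ = λ h → proj₁ (inc⁻ ∈⊤ h)
    ; meet = λ i≢j → meet ∈⊤ ∈⊤ i≢j }
    where
    module G = Greedy T forest ∅ (λ i _ → ∉⊥) (_∈ edges F) P (2 + r) κ []
      (≤-trans (≤-reflexive (cong (V T +_) (+-identityʳ (e T * (2 + r))))) κ-large)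
      (λ D∈ → ≤-reflexive (All.lookup (uniform F) D∈)) S
    open G.Embedding G.embedding

module _ {n q : ℕ} (κ : ℕ) (L : List (Subset n)) (L-unique : Unique L)
         (size : ∀ {D} → D ∈ L → ∣ D ∣ ≡ suc q) (1≤q : 1 ≤ q) (ne : 1 ≤ length L)
         (full : Full _≟ˢ_ _⊆?_ (subsetsOfSize n q) κ L) where

  private
    P : Fin n → Set
    P y = ∃ λ D → D ∈ L × y ∈ˢ D

    -- `D - u` has more than `κ` supersets in `L`, and a vertex of `us` outside `D - u` spoils at
    -- most one of them. Hence `u` can be traded for a vertex outside `us`.
    swap : ∀ {D y u} → D ∈ L → y ∈ˢ D → u ∈ˢ D → y ≢ u → (us : List (Fin n)) → length us ≤ κ →
           ∃ λ D′ → D′ ∈ L × y ∈ˢ D′ × (∀ {z} → z ∈ us → z ∈ˢ D′ → z ∈ˢ D - u)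
    swap {D} {y} {u} D∈ y∈ u∈ y≢u us le
      with avoid (D - u ⊆?_) (λ w D′ → (w ∈? D′) ×-dec ¬? (w ∈? (D - u))) L us 1 bound
             (≤-<-trans (≤-trans (≤-reflexive (*-identityʳ _)) le)
               (full (∈-subsetsOfSize⁺ (D - u) q ∣D-u∣) D∈ (λ {z} → x∈p-y⇒x∈p D u)))
      where
      ∣D-u∣ : ∣ D - u ∣ ≡ q
      ∣D-u∣ = suc-injective (trans (x∈p⇒1+∣p-x∣≡∣p∣ D u u∈) (size D∈))
      bound : ∀ {w} → w ∈ us → # (λ D′ → (D - u ⊆? D′) ×-dec ((w ∈? D′) ×-dec ¬? (w ∈? (D - u)))) L ≤ 1
      bound {w} _ = cases (w ∈? (D - u))
        where
        cases : Dec (w ∈ˢ D - u) → # (λ D′ → (D - u ⊆? D′) ×-dec ((w ∈? D′) ×-dec ¬? (w ∈? (D - u)))) L ≤ 1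
        cases (yes w∈) = #-none (λ D′ → (D - u ⊆? D′) ×-dec ((w ∈? D′) ×-dec ¬? (w ∈? (D - u)))) L λ (_ , _ , w∉) → w∉ w∈
        cases (no w∉) = #-supersets-filter 0 ((D - u) ∪ ⁅ w ⁆) (λ D′ → (D - u ⊆? D′) ×-dec ((w ∈? D′) ×-dec ¬? (w ∈? (D - u)))) L-unique
          λ D′∈ (sub , w∈ , _) → p∪⁅x⁆⊆q sub w∈ , trans (size D′∈) (sym (trans (∣p∪⁅x⁆∣≡1+∣p∣ (D - u) w w∉) (cong suc ∣D-u∣)))
    ... | D′ , D′∈ , sub , av = D′ , D′∈ , sub (x∈p∧x≢y⇒x∈p-y y∈ y≢u) , only
      where
      only : ∀ {z} → z ∈ us → z ∈ˢ D′ → z ∈ˢ D - u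
      only {z} z∈us z∈D′ with z ∈? (D - u)
      ... | yes h = h
      ... | no ¬h = contradiction (z∈D′ , ¬h) (av z∈us)

    -- Unwanted vertices are traded away one at a time. Each trade avoids all of `us` and not just
    -- the current vertex, so nothing removed earlier returns.
    clear : ∀ {y} → P y → (us vs : List (Fin n)) → length us ≤ κ → (∀ {z} → z ∈ vs → z ∈ us) →
            ∃ λ D → D ∈ L × y ∈ˢ D × (∀ {z} → z ∈ˢ D → z ≢ y → z ∉ vs)
    clear (D , D∈ , y∈) us [] le sub = D , D∈ , y∈ , λ _ _ ()
    clear {y} py us (u ∷ vs) le sub with clear py us vs le (sub ∘ there)
    ... | D , D∈ , y∈ , av with u ∈? D | y Finₚ.≟ u
    ...   | no u∉ | _ = D , D∈ , y∈ , λ { z∈ z≢ (here refl) → u∉ z∈ ; z∈ z≢ (there h) → av z∈ z≢ h }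
    ...   | yes _ | yes refl = D , D∈ , y∈ , λ { z∈ z≢ (here refl) → z≢ refl ; z∈ z≢ (there h) → av z∈ z≢ h }
    ...   | yes u∈ | no y≢u with swap D∈ y∈ u∈ y≢u us le
    ...     | D′ , D′∈ , y∈′ , only = D′ , D′∈ , y∈′ ,
      λ { z∈ z≢ (here refl) → x∉p-x D u (only (sub (here refl)) z∈)
        ; z∈ z≢ (there h) → av (x∈p-y⇒x∈p D u (only (sub (there h)) z∈)) z≢ h }

  full⇒spread : ∃ λ P → Spread κ (_∈ L) P
  full⇒spread = P , record
    { root = let (D , D∈) = length>0⇒∃ ne
                 (y , y∈ , _) = ∣p∣<∣q∣⇒∃ ∅ D (subst₂ _<_ (sym (∣⊥∣≡0 n)) (sym (size D∈)) (s≤s z≤n))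
             in y , D , D∈ , y∈
    ; extend = λ y py us le →
        let (D , D∈ , y∈ , av) = clear py us us le (λ h → h)
            (z , z∈ , z≢) = second-element D y (subst (2 ≤_) (sym (size D∈)) (s≤s 1≤q))
        in D , D∈ , y∈ , av , z , z∈ , z≢ , D , D∈ , z∈ }

-- A vertex y is bad for D if a positive proportion of the sets through y have the same value of x
-- as D. If most D have at most one bad vertex, then each keeps two good ones, and few sets through
-- a good vertex are blocked by a given value. If most D have two bad vertices, then averaging
-- fixes one bad vertex y, then a value u, and finds linearly many y′ having u as a frequent value.
module Dichotomy {n r : ℕ} (κ d : ℕ) (1≤κ : 1 ≤ κ) (1≤d : 1 ≤ d) (n-large : 4 * d * κ < n)
  (L : List (Subset n)) (L-unique : Unique L) (size : ∀ {D} → D ∈ L → ∣ D ∣ ≡ 3 + r)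
  (x : Subset n → Fin n) (x∉ : ∀ {D} → D ∈ L → x D ∉ˢ D)
  (dense : n ^ (3 + r) ≤ d * length L) where

  -- With this value, `n * κ * (n ^ (2 + r) / g)` is at most `n ^ (3 + r) / (4 * d)`, half of the
  -- size that `few⇒spread` assumes for `L₁`.
  g : ℕ
  g = 4 * d * κ

  1≤g : 1 ≤ g
  1≤g = *-mono-≤ (*-mono-≤ (s≤s {n = 3} z≤n) 1≤d) 1≤κ

  instance
    g≢0 : NonZero g
    g≢0 = >-nonZero 1≤g
    n≢0 : NonZero n
    n≢0 = >-nonZero (≤-trans (s≤s z≤n) n-large)

  deg : Fin n → Fin n → ℕ
  deg y u = # (λ D → (y ∈? D) ×-dec (x D Finₚ.≟ u)) L

  -- At most `n ^ (2 + r)` sets of `L` contain `y`; the value `u` is popular at `y` if it accounts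
  -- for more than `1/g` of this maximum.
  Heavy : Fin n → Fin n → Set
  Heavy y u = n ^ (2 + r) < g * deg y u

  Heavy? : ∀ y u → Dec (Heavy y u)
  Heavy? y u = n ^ (2 + r) <? g * deg y u

  bad? : ∀ D y → Dec (y ∈ˢ D × Heavy y (x D))
  bad? D y = (y ∈? D) ×-dec Heavy? y (x D)

  #bad : Subset n → ℕ
  #bad D = # (bad? D) (allFin n)

  few? : ∀ D → Dec (#bad D ≤ 1)
  few? D = #bad D ≤? 1

  L₁ L₂ : List (Subset n)
  L₁ = filter few? L
  L₂ = filter (¬? ∘ few?) L

  good? : ∀ y D → Dec (y ∈ˢ D × ¬ Heavy y (x D))
  good? y D = (y ∈? D) ×-dec ¬? (Heavy? y (x D))

  another-good : ∀ {D y} → D ∈ L → #bad D ≤ 1 → ∃ λ z → z ∈ˢ D × z ≢ y × ¬ Heavy z (x D)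
  another-good {D} {y} D∈ few with Finₚ.any? (λ z → (z ∈? D) ×-dec ¬? (z Finₚ.≟ y) ×-dec ¬? (Heavy? z (x D)))
  ... | yes h = h
  ... | no ¬h = contradiction (≤-trans (Unique-⊆⇒length≤ {ys = y ∷ filter (bad? D) (allFin n)} (elements-unique D) sub) (s≤s few))
                  (<⇒≱ (subst (2 <_) (sym (trans (length-elements D) (size D∈))) (s≤s (s≤s (s≤s z≤n)))))
    where
    sub : ∀ {z} → z ∈ elements D → z ∈ y ∷ filter (bad? D) (allFin n)
    sub {z} z∈ with z Finₚ.≟ y | Heavy? z (x D)
    ... | yes p | _ = here p
    ... | no _ | yes hv = there (∈-filter⁺ (bad? D) (∈-allFin z) (∈-elements⁻ D z∈ , hv))
    ... | no z≢ | no ¬hv = contradiction (z , ∈-elements⁻ D z∈ , z≢ , ¬hv) ¬h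

  another-bad : ∀ {D y} → ¬ (#bad D ≤ 1) → ∃ λ z → z ∈ˢ D × z ≢ y × Heavy z (x D)
  another-bad {D} {y} many with Finₚ.any? (λ z → (z ∈? D) ×-dec ¬? (z Finₚ.≟ y) ×-dec Heavy? z (x D))
  ... | yes h = h
  ... | no ¬h = contradiction (Unique∧const⇒length≤1 y (Uniqueₚ.filter⁺ (bad? D) (Uniqueₚ.allFin⁺ n)) only) many
    where
    only : ∀ {z} → z ∈ filter (bad? D) (allFin n) → z ≡ y
    only {z} z∈ with z Finₚ.≟ y | ∈-filter⁻ (bad? D) {xs = allFin n} z∈
    ... | yes p | _ = p
    ... | no z≢ | _ , z∈D , hv = contradiction (z , z∈D , z≢ , hv) ¬h

  -- Among the sets in which `y` is good, one used vertex `u` blocks at most this many: the first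
  -- summand is for `u` in the set, the second for `u` as its value.
  b : ℕ
  b = n ^ (1 + r) + n ^ (2 + r) / g

  -- Each of the two summands of b contributes less than half, as g = 4dκ < n.
  b-small : 2 * d * (κ * b) < n ^ (2 + r)
  b-small = *-cancelˡ-< g _ _ (begin-strict
    g * (2 * d * (κ * b))
      ≡⟨ r₁ g d κ (n ^ (1 + r)) (n ^ (2 + r) / g) ⟩
    2 * d * κ * (g * n ^ (1 + r)) + 2 * d * κ * (n ^ (2 + r) / g * g)
      ≤⟨ +-monoʳ-≤ _ (*-monoʳ-≤ (2 * d * κ) (m/n*n≤m (n ^ (2 + r)) g)) ⟩
    2 * d * κ * (g * n ^ (1 + r)) + 2 * d * κ * n ^ (2 + r)
      <⟨ +-monoˡ-< _ (*-monoʳ-< (2 * d * κ) {{>-nonZero (*-mono-≤ (*-mono-≤ (s≤s {n = 1} z≤n) 1≤d) 1≤κ)}}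
           (*-monoˡ-< (n ^ (1 + r)) {{m^n≢0 n (1 + r)}} n-large)) ⟩
    2 * d * κ * (n * n ^ (1 + r)) + 2 * d * κ * n ^ (2 + r)
      ≡⟨ r₂ d κ (n ^ (2 + r)) ⟩
    g * n ^ (2 + r) ∎)
    where
    open ≤-Reasoning
    r₁ : ∀ g d κ u v → g * (2 * d * (κ * (u + v))) ≡ 2 * d * κ * (g * u) + 2 * d * κ * (v * g)
    r₁ = solve-∀
    r₂ : ∀ d κ u → 2 * d * κ * u + 2 * d * κ * u ≡ 4 * d * κ * u
    r₂ = solve-∀

  light⇒deg≤ : ∀ {y u} → ¬ Heavy y u → deg y u ≤ n ^ (2 + r) / g
  light⇒deg≤ {y} {u} ¬hv = subst (_≤ n ^ (2 + r) / g) (m*n/n≡m (deg y u) g)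
    (/-monoˡ-≤ g (subst (_≤ n ^ (2 + r)) (*-comm g (deg y u)) (≮⇒≥ ¬hv)))

  Extends : Subset n → Set
  Extends S = ∃ λ D → D ∈ L × S ≡ D ∪ ⁅ x D ⁆

  -- Sets are pruned by their good vertices. Exhaustion would make `L₁` too small, by `b-small`. In
  -- what survives, a vertex good in some set is good in more than `κ * b` sets, which `κ` used
  -- vertices cannot all block.
  few⇒spread : n ^ (3 + r) ≤ 2 * d * length L₁ → ∃ λ P → Spread κ Extends P
  few⇒spread big with prune Finₚ._≟_ good? (allFin n) (κ * b) y₀ (length L₁) L₁ (Uniqueₚ.filter⁺ few? L-unique) ≤-refl
    where y₀ : Fin n
          y₀ = fromℕ< {0} (≤-trans (s≤s z≤n) n-large)
  ... | inj₂ (a , ok , fib) = contradiction big (<⇒≱ (begin-strict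
      2 * d * length L₁                  ≤⟨ *-monoʳ-≤ (2 * d) (union-bound (λ y D → a D Finₚ.≟ y) L₁ (allFin n) (κ * b)
                                              (λ {D} _ → a D , ∈-allFin _ , refl) (λ {y} _ → fib y)) ⟩
      2 * d * (length (allFin n) * (κ * b)) ≡⟨ cong (λ m → 2 * d * (m * (κ * b))) (length-allFin n) ⟩
      2 * d * (n * (κ * b))              ≡⟨ r₁ d n (κ * b) ⟩
      n * (2 * d * (κ * b))              <⟨ *-monoʳ-< n b-small ⟩
      n * n ^ (2 + r)                    ∎))
    where
    open ≤-Reasoning
    r₁ : ∀ d n u → 2 * d * (n * u) ≡ n * (2 * d * u)
    r₁ = solve-∀
  ... | inj₁ (L′ , ne , uq , sub , full) = P , record { root = root ; extend = extend }
    where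
    P : Fin n → Set
    P y = ∃ λ D → D ∈ L′ × y ∈ˢ D × ¬ Heavy y (x D)
    inL : ∀ {D} → D ∈ L′ → D ∈ L × #bad D ≤ 1
    inL D∈ = ∈-filter⁻ few? (sub D∈)
    root : ∃ P
    root with length>0⇒∃ ne
    ... | D , D∈ with ∣p∣<∣q∣⇒∃ ∅ D (subst₂ _<_ (sym (∣⊥∣≡0 n)) (sym (size (proj₁ (inL D∈)))) (s≤s z≤n))
    ...   | y , _ with another-good {y = y} (proj₁ (inL D∈)) (proj₂ (inL D∈))
    ...     | z , z∈ , _ , ¬hv = z , D , D∈ , z∈ , ¬hv
    Extension : Fin n → List (Fin n) → Set
    Extension y us = Σ (Subset n) λ S → Extends S × y ∈ˢ S × (∀ {z} → z ∈ˢ S → z ≢ y → z ∉ us) ×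
               ∃ λ y′ → y′ ∈ˢ S × y′ ≢ y × P y′
    extend : ∀ y → P y → (us : List (Fin n)) → length us ≤ κ →
             Extension y us
    extend y (D₀ , D₀∈ , y∈D₀ , ¬hv₀) us le = result
      where
      R? : ∀ u D → Dec ((u ≢ y × u ∈ˢ D) ⊎ (x D ≡ u))
      R? u D = (¬? (u Finₚ.≟ y) ×-dec (u ∈? D)) ⊎-dec (x D Finₚ.≟ u)
      through : ∀ u → # (λ D → good? y D ×-dec (¬? (u Finₚ.≟ y) ×-dec (u ∈? D))) L′ ≤ n ^ (1 + r)
      through u = cases (u Finₚ.≟ y)
        where
        cases : Dec (u ≡ y) → # (λ D → good? y D ×-dec (¬? (u Finₚ.≟ y) ×-dec (u ∈? D))) L′ ≤ n ^ (1 + r)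
        cases (yes p) = #-none (λ D → good? y D ×-dec (¬? (u Finₚ.≟ y) ×-dec (u ∈? D))) L′ (λ (_ , u≢ , _) → u≢ p)
        cases (no u≢) = #-through-pair (1 + r) u≢ uq (λ D∈ → size (proj₁ (inL D∈)))
          (λ D → good? y D ×-dec (¬? (u Finₚ.≟ y) ×-dec (u ∈? D))) (λ _ ((y∈ , _) , _ , u∈) → y∈ , u∈)
      -- A set in which `y` is good never takes a value popular at `y`, so only unpopular `u`
      -- contribute.
      valued : ∀ u → # (λ D → good? y D ×-dec (x D Finₚ.≟ u)) L′ ≤ n ^ (2 + r) / g
      valued u = cases (Heavy? y u)
        where
        cases : Dec (Heavy y u) → # (λ D → good? y D ×-dec (x D Finₚ.≟ u)) L′ ≤ n ^ (2 + r) / g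
        cases (yes hv) = #-none (λ D → good? y D ×-dec (x D Finₚ.≟ u)) L′ (λ { ((_ , ¬hv) , refl) → ¬hv hv })
        cases (no ¬hv) = ≤-trans (Unique-⊆⇒length≤ (Uniqueₚ.filter⁺ (λ D → good? y D ×-dec (x D Finₚ.≟ u)) uq) into) (light⇒deg≤ ¬hv)
          where
          into : ∀ {D} → D ∈ filter (λ D → good? y D ×-dec (x D Finₚ.≟ u)) L′ →
                 D ∈ filter (λ D → (y ∈? D) ×-dec (x D Finₚ.≟ u)) L
          into D∈ with ∈-filter⁻ (λ D → good? y D ×-dec (x D Finₚ.≟ u)) {xs = L′} D∈
          ... | D∈L′ , (y∈ , _) , eq = ∈-filter⁺ (λ D → (y ∈? D) ×-dec (x D Finₚ.≟ u)) (proj₁ (inL D∈L′)) (y∈ , eq)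
      blocked : ∀ {u} → u ∈ us → # (λ D → good? y D ×-dec R? u D) L′ ≤ b
      blocked {u} _ = ≤-trans
        (#-⊎ (λ D → good? y D ×-dec R? u D) (λ D → good? y D ×-dec (¬? (u Finₚ.≟ y) ×-dec (u ∈? D)))
             (λ D → good? y D ×-dec (x D Finₚ.≟ u)) L′
             (λ { _ (gd , inj₁ h) → inj₁ (gd , h) ; _ (gd , inj₂ h) → inj₂ (gd , h) }))
        (+-mono-≤ (through u) (valued u))
      result : Extension y us
      result with avoid (good? y) R? L′ us b blocked (≤-<-trans (*-monoˡ-≤ b le) (full (∈-allFin y) D₀∈ (y∈D₀ , ¬hv₀)))
      ... | D , D∈ , (y∈ , ¬hv) , av with another-good {y = y} (proj₁ (inL D∈)) (proj₂ (inL D∈))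
      ...   | z , z∈ , z≢ , ¬hvz = D ∪ ⁅ x D ⁆ , (D , proj₁ (inL D∈) , refl) , x∈p∪q⁺ (inj₁ y∈) , (λ {w} → free {w}) ,
              z , x∈p∪q⁺ (inj₁ z∈) , z≢ , D , D∈ , z∈ , ¬hvz
        where
        free : ∀ {w} → w ∈ˢ D ∪ ⁅ x D ⁆ → w ≢ y → w ∉ us
        free {w} w∈ w≢ w∈us with x∈p∪q⁻ D ⁅ x D ⁆ w∈
        ... | inj₁ h = av w∈us (inj₁ (w≢ , h))
        ... | inj₂ h = av w∈us (inj₂ (sym (x∈⁅y⁆⇒x≡y (x D) h)))

  fibre : Fin n → ℕ
  fibre u = # (λ D → x D Finₚ.≟ u) L

  -- Different values belong to disjoint families of sets through `y`, and each popular one takes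
  -- more than `1/g` of the maximal number of such sets.
  heavy-values : ∀ y → # (Heavy? y) (allFin n) ≤ g
  heavy-values y = *-cancelʳ-≤ _ _ (n ^ (2 + r)) {{m^n≢0 n (2 + r)}} (begin
    length Hs * n ^ (2 + r)      ≤⟨ degree-bound (λ u D → x D Finₚ.≟ u) (filter (y ∈?_) L) Hs g (n ^ (2 + r)) 1 lo hi ⟩
    g * (# (y ∈?_) L * 1)        ≡⟨ cong (g *_) (*-identityʳ _) ⟩
    g * # (y ∈?_) L              ≤⟨ *-monoʳ-≤ g (#-through-point (2 + r) y L-unique size) ⟩
    g * n ^ (2 + r)              ∎)
    where
    open ≤-Reasoning
    Hs = filter (Heavy? y) (allFin n)
    lo : ∀ {u} → u ∈ Hs → n ^ (2 + r) ≤ g * # (λ D → x D Finₚ.≟ u) (filter (y ∈?_) L)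
    lo {u} u∈ = ≤-trans (<⇒≤ (proj₂ (∈-filter⁻ (Heavy? y) {xs = allFin n} u∈)))
      (≤-reflexive (cong (g *_) (sym (#-filter (y ∈?_) (λ D → x D Finₚ.≟ u) L))))
    hi : ∀ {D} → D ∈ filter (y ∈?_) L → # (λ u → x D Finₚ.≟ u) Hs ≤ 1
    hi {D} _ = Unique∧const⇒length≤1 (x D)
      (Uniqueₚ.filter⁺ (λ u → x D Finₚ.≟ u) (Uniqueₚ.filter⁺ (Heavy? y) (Uniqueₚ.allFin⁺ n)))
      (λ u∈ → sym (proj₂ (∈-filter⁻ (λ u → x D Finₚ.≟ u) {xs = Hs} u∈)))

  -- Origin of the factor: `2 * d` is the density of `L₂`, one `g` pays for choosing `u` among the
  -- popular values at `y`, the other `g` is the popularity of `u` at each further vertex, and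
  -- `3 + r` is how often a set is counted through its vertices.
  many⇒constant : n ^ (3 + r) ≤ 2 * d * length L₂ → ∃ λ u → n ^ (3 + r) ≤ 2 * d * g * g * (3 + r) * fibre u
  many⇒constant big = step₁ (pigeonhole (λ y D → bad? D y) L₂ (allFin n) (nonempty (3 + r) (length L₂) big) cov)
    where
    open ≤-Reasoning
    nonempty : ∀ a m → n ^ a ≤ 2 * d * m → 1 ≤ m
    nonempty a zero le = contradiction (≤-trans (m^n>0 n a) (≤-trans le (≤-reflexive (*-zeroʳ (2 * d))))) λ ()
    nonempty a (suc m) le = s≤s z≤n
    y₀ : Fin n
    y₀ = fromℕ< {0} (≤-trans (s≤s z≤n) n-large)
    cov : ∀ {D} → D ∈ L₂ → ∃ λ y → y ∈ allFin n × y ∈ˢ D × Heavy y (x D)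
    cov D∈ = let (z , z∈ , _ , hv) = another-bad {y = y₀} (proj₂ (∈-filter⁻ (¬? ∘ few?) {xs = L} D∈)) in z , ∈-allFin z , z∈ , hv
    step₁ : (∃ λ y → y ∈ allFin n × length L₂ ≤ length (allFin n) * # (λ D → bad? D y) L₂) → _
    step₁ (y , _ , le₁) = step₂ (pigeonhole (λ u D → x D Finₚ.≟ u) L₃ Hs L₃>0 cov₂)
      where
      L₃ = filter (λ D → bad? D y) L₂
      Hs = filter (Heavy? y) (allFin n)
      L₃-big : n ^ (2 + r) ≤ 2 * d * length L₃
      L₃-big = *-cancelˡ-≤ n (begin
        n * n ^ (2 + r)                        ≤⟨ big ⟩
        2 * d * length L₂                      ≤⟨ *-monoʳ-≤ (2 * d) le₁ ⟩
        2 * d * (length (allFin n) * length L₃) ≡⟨ cong (λ m → 2 * d * (m * length L₃)) (length-allFin n) ⟩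
        2 * d * (n * length L₃)                ≡⟨ +-*-exchange (2 * d) n (length L₃) ⟩
        n * (2 * d * length L₃)                ∎)
        where
        +-*-exchange : ∀ a b c → a * (b * c) ≡ b * (a * c)
        +-*-exchange = solve-∀
      L₃>0 : 1 ≤ length L₃
      L₃>0 = nonempty (2 + r) (length L₃) L₃-big
      cov₂ : ∀ {D} → D ∈ L₃ → ∃ λ u → u ∈ Hs × x D ≡ u
      cov₂ {D} D∈ with ∈-filter⁻ (λ D → bad? D y) {xs = L₂} D∈
      ... | _ , _ , hv = x D , ∈-filter⁺ (Heavy? y) (∈-allFin (x D)) hv , refl
      step₂ : (∃ λ u → u ∈ Hs × length L₃ ≤ length Hs * # (λ D → x D Finₚ.≟ u) L₃) → _
      step₂ (u , _ , le₂) = u , (begin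
          n * n ^ (2 + r)                                ≤⟨ *-monoˡ-≤ (n ^ (2 + r)) Ys-big ⟩
          2 * d * (g * length Ys) * n ^ (2 + r)          ≡⟨ r₂ d g (length Ys) (n ^ (2 + r)) ⟩
          2 * d * g * (length Ys * n ^ (2 + r))          ≤⟨ *-monoʳ-≤ (2 * d * g) (degree-bound (λ z D → z ∈? D) (filter (λ D → x D Finₚ.≟ u) L) Ys g (n ^ (2 + r)) (3 + r) lo hi) ⟩
          2 * d * g * (g * (fibre u * (3 + r)))          ≡⟨ r₃ d g (fibre u) (3 + r) ⟩
          2 * d * g * g * (3 + r) * fibre u              ∎)
        where
        r₂ : ∀ d g a b → 2 * d * (g * a) * b ≡ 2 * d * g * (a * b)
        r₂ = solve-∀
        r₃ : ∀ d g a b → 2 * d * g * (g * (a * b)) ≡ 2 * d * g * g * b * a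
        r₃ = solve-∀
        r₄ : ∀ d g a b → 2 * d * (g * (a * b)) ≡ 2 * d * (g * a) * b
        r₄ = solve-∀
        L₄ = filter (λ D → x D Finₚ.≟ u) L₃
        Y? : ∀ z → Dec (z ≢ y × Heavy z u)
        Y? z = ¬? (z Finₚ.≟ y) ×-dec Heavy? z u
        Ys = filter Y? (allFin n)
        L₂-unique : Unique L₂
        L₂-unique = Uniqueₚ.filter⁺ (¬? ∘ few?) L-unique
        L₄-unique : Unique L₄
        L₄-unique = Uniqueₚ.filter⁺ (λ D → x D Finₚ.≟ u) (Uniqueₚ.filter⁺ (λ D → bad? D y) L₂-unique)
        L₄⁻ : ∀ {D} → D ∈ L₄ → D ∈ L × ¬ (#bad D ≤ 1) × y ∈ˢ D × x D ≡ u
        L₄⁻ D∈ with ∈-filter⁻ (λ D → x D Finₚ.≟ u) {xs = L₃} D∈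
        ... | D∈₃ , eq with ∈-filter⁻ (λ D → bad? D y) {xs = L₂} D∈₃
        ...   | D∈₂ , y∈ , _ with ∈-filter⁻ (¬? ∘ few?) {xs = L} D∈₂
        ...     | D∈L , many = D∈L , many , y∈ , eq
        cov₃ : ∀ {D} → D ∈ L₄ → ∃ λ z → z ∈ Ys × z ∈ˢ D
        cov₃ {D} D∈ with L₄⁻ D∈
        ... | _ , many , _ , eq with another-bad {y = y} many
        ...   | z , z∈ , z≢ , hv = z , ∈-filter⁺ Y? (∈-allFin z) (z≢ , subst (Heavy z) eq hv) , z∈
        pair : ∀ {z} → z ∈ Ys → # (z ∈?_) L₄ ≤ n ^ (1 + r)
        pair {z} z∈ = #-through-pair (1 + r) (proj₁ (proj₂ (∈-filter⁻ Y? {xs = allFin n} z∈))) L₄-unique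
          (λ D∈ → size (proj₁ (L₄⁻ D∈))) (z ∈?_) (λ D∈ z∈D → proj₁ (proj₂ (proj₂ (L₄⁻ D∈))) , z∈D)
        -- Every set of `L₄` contains `y` and some vertex of `Ys`. As a pair of vertices lies in at
        -- most `n ^ (1 + r)` of them, `Ys` has linear size.
        Ys-big : n ≤ 2 * d * (g * length Ys)
        Ys-big = *-cancelʳ-≤ _ _ (n ^ (1 + r)) {{m^n≢0 n (1 + r)}} (begin
          n * n ^ (1 + r)                              ≤⟨ L₃-big ⟩
          2 * d * length L₃                            ≤⟨ *-monoʳ-≤ (2 * d) (≤-trans le₂ (*-monoˡ-≤ (length L₄) (heavy-values y))) ⟩
          2 * d * (g * length L₄)                      ≤⟨ *-monoʳ-≤ (2 * d) (*-monoʳ-≤ g (union-bound (λ z D → z ∈? D) L₄ Ys (n ^ (1 + r)) cov₃ pair)) ⟩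
          2 * d * (g * (length Ys * n ^ (1 + r)))      ≡⟨ r₄ d g (length Ys) (n ^ (1 + r)) ⟩
          2 * d * (g * length Ys) * n ^ (1 + r)        ∎)
        lo : ∀ {z} → z ∈ Ys → n ^ (2 + r) ≤ g * # (z ∈?_) (filter (λ D → x D Finₚ.≟ u) L)
        lo {z} z∈ = ≤-trans (<⇒≤ (proj₂ (proj₂ (∈-filter⁻ Y? {xs = allFin n} z∈))))
          (*-monoʳ-≤ g (≤-trans (#-mono (λ D → (z ∈? D) ×-dec (x D Finₚ.≟ u)) (λ D → (x D Finₚ.≟ u) ×-dec (z ∈? D)) L (λ _ (p , q) → q , p))
            (≤-reflexive (sym (#-filter (λ D → x D Finₚ.≟ u) (z ∈?_) L)))))
        hi : ∀ {D} → D ∈ filter (λ D → x D Finₚ.≟ u) L → # (_∈? D) Ys ≤ 3 + r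
        hi {D} D∈ = ≤-trans (Unique-⊆⇒length≤ (Uniqueₚ.filter⁺ (_∈? D) (Uniqueₚ.filter⁺ Y? (Uniqueₚ.allFin⁺ n)))
            (λ z∈ → ∈-elements⁺ (proj₂ (∈-filter⁻ (_∈? D) {xs = Ys} z∈))))
          (≤-reflexive (trans (length-elements D) (size (proj₁ (∈-filter⁻ (λ D → x D Finₚ.≟ u) {xs = L} D∈)))))

  dichotomy : (∃ λ P → Spread κ Extends P) ⊎ ∃ λ u → n ^ (3 + r) ≤ 2 * d * g * g * (3 + r) * fibre u
  dichotomy with n ^ (3 + r) ≤? 2 * d * length L₁ | n ^ (3 + r) ≤? 2 * d * length L₂
  ... | yes p | _ = inj₁ (few⇒spread p)
  ... | no _ | yes q = inj₂ (many⇒constant q)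
  ... | no p | no q = contradiction (+-mono-< (≰⇒> p) (≰⇒> q)) (≤⇒≯ (begin
      n ^ (3 + r) + n ^ (3 + r)                    ≤⟨ +-mono-≤ dense dense ⟩
      d * length L + d * length L                  ≡⟨ r₁ d (length L) ⟩
      2 * d * length L                             ≤⟨ *-monoʳ-≤ (2 * d) (length≤#+# few? L) ⟩
      2 * d * (length L₁ + length L₂)              ≡⟨ *-distribˡ-+ (2 * d) (length L₁) (length L₂) ⟩
      2 * d * length L₁ + 2 * d * length L₂        ∎))
    where
    open ≤-Reasoning
    r₁ : ∀ d a → d * a + d * a ≡ 2 * d * a
    r₁ = solve-∀

-- The weight of an independent set, and the case of constant extensions.

#-map : {A B : Set} {P : B → Set} (P? : Decidable P) (f : A → B) (xs : List A) → # P? (map f xs) ≡ # (P? ∘ f) xs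
#-map P? f [] = refl
#-map P? f (x ∷ xs) with P? (f x)
... | yes _ = cong suc (#-map P? f xs)
... | no _  = #-map P? f xs

#-allFin : {A : Set} {P : A → Set} (P? : Decidable P) (xs : List A) → # (P? ∘ lookup xs) (allFin (length xs)) ≡ # P? xs
#-allFin P? xs = trans (sym (#-map P? (lookup xs) (allFin (length xs))))
  (cong (# P?) (trans (map-tabulate (λ i → i) (lookup xs)) (tabulate-lookup xs)))

module Weight (T : Graph) (X : Subset (V T)) where

  untouched? : (ab : Fin (V T) × Fin (V T)) → Dec (proj₁ ab ∉ˢ X × proj₂ ab ∉ˢ X)
  untouched? (a , b) = ¬? (a ∈? X) ×-dec ¬? (b ∈? X)

  Untouched : Fin (e T) → Set
  Untouched i = end T false i ∉ˢ X × end T true i ∉ˢ X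

  eMinus≡# : (xs : List (Fin (V T) × Fin (V T))) →
    sum (map (λ xy → if Vec.lookup X (proj₁ xy) ∨ Vec.lookup X (proj₂ xy) then 0 else 1) xs) ≡ # untouched? xs
  eMinus≡# [] = refl
  eMinus≡# ((a , b) ∷ xs) with a ∈? X | b ∈? X
  ... | yes a∈ | _ rewrite []=⇒lookup a∈ = eMinus≡# xs
  ... | no a∉ | yes b∈ rewrite []=⇒lookup b∈ | ∨-zeroʳ (Vec.lookup X a) = eMinus≡# xs
  ... | no a∉ | no b∉ with Vec.lookup X a in eqa | Vec.lookup X b in eqb
  ...   | true  | _     = contradiction (lookup⇒[]= a X eqa) a∉
  ...   | false | true  = contradiction (lookup⇒[]= b X eqb) b∉
  ...   | false | false = cong suc (eMinus≡# xs)

  -- The vertices and edges counted by |X| + e(T ∖ X).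
  W : List (Fin (V T) ⊎ Fin (e T))
  W = map inj₁ (elements X) ++ map inj₂ (filter (untouched? ∘ lookup (E T)) (allFin (e T)))

  length-W : length W ≡ ∣ X ∣ + eMinus T X
  length-W = begin
    length W ≡⟨ length-++ (map inj₁ (elements X)) ⟩
    length (map {B = Fin (V T) ⊎ Fin (e T)} inj₁ (elements X)) + length (map {B = Fin (V T) ⊎ Fin (e T)} inj₂ (filter (untouched? ∘ lookup (E T)) (allFin (e T))))
      ≡⟨ cong₂ _+_ (trans (length-map inj₁ (elements X)) (length-elements X))
           (trans (length-map inj₂ (filter (untouched? ∘ lookup (E T)) (allFin (e T))))
             (trans (#-allFin untouched? (E T)) (sym (eMinus≡# (E T))))) ⟩
    ∣ X ∣ + eMinus T X ∎
    where open ≡-Reasoning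

  W-unique : Unique W
  W-unique = Uniqueₚ.++⁺ (Uniqueₚ.map⁺ inj₁-injective (elements-unique X))
    (Uniqueₚ.map⁺ inj₂-injective (Uniqueₚ.filter⁺ (untouched? ∘ lookup (E T)) (Uniqueₚ.allFin⁺ (e T))))
    disjoint
    where
    disjoint : ∀ {w} → w ∈ map inj₁ (elements X) × w ∈ map inj₂ (filter (untouched? ∘ lookup (E T)) (allFin (e T))) → ⊥
    disjoint (p , q) with ∈-map⁻ inj₁ p | ∈-map⁻ inj₂ q
    ... | _ , _ , refl | _ , _ , ()

  vertex∈W : ∀ {v} → v ∈ˢ X → inj₁ v ∈ W
  vertex∈W v∈ = ∈-++⁺ˡ (∈-map⁺ inj₁ (∈-elements⁺ v∈))

  edge∈W : ∀ {i} → Untouched i → inj₂ i ∈ W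
  edge∈W {i} h = ∈-++⁺ʳ (map inj₁ (elements X)) (∈-map⁺ inj₂ (∈-filter⁺ (untouched? ∘ lookup (E T)) (∈-allFin i) h))

  ∈W⁻ : ∀ {w} → w ∈ W → (∃ λ v → w ≡ inj₁ v × v ∈ˢ X) ⊎ (∃ λ i → w ≡ inj₂ i × Untouched i)
  ∈W⁻ w∈ with ∈-++⁻ (map inj₁ (elements X)) w∈
  ... | inj₁ p = let (v , v∈ , eq) = ∈-map⁻ inj₁ p in inj₁ (v , eq , ∈-elements⁻ X v∈)
  ... | inj₂ p = let (i , i∈ , eq) = ∈-map⁻ inj₂ p in
    inj₂ (i , eq , proj₂ (∈-filter⁻ (untouched? ∘ lookup (E T)) {xs = allFin (e T)} i∈))

  W-nonempty : Fin (e T) → 1 ≤ length W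
  W-nonempty i with end T false i ∈? X | end T true i ∈? X
  ... | yes p | _ = ∈⇒length>0 (vertex∈W p)
  ... | no _ | yes q = ∈⇒length>0 (vertex∈W q)
  ... | no p | no q = ∈⇒length>0 (edge∈W (p , q))

-- Sets are pruned by their vertices with threshold `κ * n ^ r`, since a pair of vertices lies in at
-- most `n ^ r` sets. Exhaustion would leave at most `n * (κ * n ^ r)` sets, too few because
-- `d * κ < n`.
dense⇒spread : {n r : ℕ} (κ d : ℕ) → d * κ < n → (L : List (Subset n)) → Unique L →
  (∀ {D} → D ∈ L → ∣ D ∣ ≡ 2 + r) → n ^ (2 + r) ≤ d * length L → ∃ λ P → Spread κ (_∈ L) P
dense⇒spread {n} {r} κ d n-large L L-unique size dense
  with prune Finₚ._≟_ (λ y D → y ∈? D) (allFin n) (κ * n ^ r) (fromℕ< {0} (≤-trans (s≤s z≤n) n-large)) (length L) L L-unique ≤-refl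
... | inj₂ (a , ok , fib) = contradiction dense (<⇒≱ (begin-strict
    d * length L                             ≤⟨ *-monoʳ-≤ d (union-bound (λ y D → a D Finₚ.≟ y) L (allFin n) (κ * n ^ r)
                                                  (λ {D} _ → a D , ∈-allFin _ , refl) (λ {y} _ → fib y)) ⟩
    d * (length (allFin n) * (κ * n ^ r))    ≡⟨ cong (λ m → d * (m * (κ * n ^ r))) (length-allFin n) ⟩
    d * (n * (κ * n ^ r))                    ≡⟨ r₁ d n κ (n ^ r) ⟩
    d * κ * n ^ (1 + r)                      <⟨ *-monoˡ-< (n ^ (1 + r)) {{m^n≢0 n (1 + r) {{>-nonZero (≤-trans (s≤s z≤n) n-large)}}}} n-large ⟩
    n * n ^ (1 + r)                          ∎))
  where
  open ≤-Reasoning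
  r₁ : ∀ d n κ u → d * (n * (κ * u)) ≡ d * κ * (n * u)
  r₁ = solve-∀
... | inj₁ (L′ , ne , uq , sub , full) = P , record { root = root ; extend = extend }
  where
  P : Fin n → Set
  P y = ∃ λ D → D ∈ L′ × y ∈ˢ D
  root : ∃ P
  root with length>0⇒∃ ne
  ... | D , D∈ with ∣p∣<∣q∣⇒∃ ∅ D (subst₂ _<_ (sym (∣⊥∣≡0 n)) (sym (size (sub D∈))) (s≤s z≤n))
  ...   | y , y∈ , _ = y , D , D∈ , y∈
  extend : ∀ y → P y → (us : List (Fin n)) → length us ≤ κ →
    Σ (Subset n) λ D → D ∈ L × y ∈ˢ D × (∀ {z} → z ∈ˢ D → z ≢ y → z ∉ us) × ∃ λ y′ → y′ ∈ˢ D × y′ ≢ y × P y′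
  extend y (D₀ , D₀∈ , y∈D₀) us le =
    let (D , D∈ , y∈ , av) = avoid (y ∈?_) R? L′ us (n ^ r) (λ {u} _ → through u)
                               (≤-<-trans (*-monoˡ-≤ (n ^ r) le) (full (∈-allFin y) D₀∈ y∈D₀))
        (z , z∈ , z≢) = second-element D y (subst (2 ≤_) (sym (size (sub D∈))) (s≤s (s≤s z≤n)))
    in D , sub D∈ , y∈ , (λ w∈ w≢ w∈us → av w∈us (w≢ , w∈)) , z , z∈ , z≢ , D , D∈ , z∈
    where
    R? : ∀ u D → Dec (u ≢ y × u ∈ˢ D)
    R? u D = ¬? (u Finₚ.≟ y) ×-dec (u ∈? D)
    through : ∀ u → # (λ D → (y ∈? D) ×-dec R? u D) L′ ≤ n ^ r
    through u = cases (u Finₚ.≟ y)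
      where
      cases : Dec (u ≡ y) → # (λ D → (y ∈? D) ×-dec R? u D) L′ ≤ n ^ r
      cases (yes p) = #-none (λ D → (y ∈? D) ×-dec R? u D) L′ (λ (_ , u≢ , _) → u≢ p)
      cases (no u≢) = #-through-pair r u≢ uq (λ D∈ → size (sub D∈)) (λ D → (y ∈? D) ×-dec R? u D) (λ _ (y∈ , _ , u∈) → y∈ , u∈)

module ConstantExtensions (T : Graph) (forest : IsForest T) (X : Subset (V T))
  (indep : ∀ i → end T false i ∈ˢ X → end T true i ∉ˢ X)
  {r n : ℕ} (F : UHypergraph (4 + r) n) (κ : ℕ) (c : Fin (length (Weight.W T X)) → Fin n)
  (c-inj : ∀ {i j} → c i ≡ c j → i ≡ j)
  (κ-large : V T + (e T * (3 + r) + length (Weight.W T X)) ≤ κ)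
  (L : List (Subset n)) (size : ∀ {D} → D ∈ L → ∣ D ∣ ≡ 3 + r)
  (c-ext : ∀ {D} → D ∈ L → ∀ j → D ∪ ⁅ c j ⁆ ∈ edges F)
  {P : Fin n → Set} (spread : Spread κ (_∈ L) P) where

  open Weight T X

  us : List (Fin n)
  us = map c (allFin (length W))

  c∈us : ∀ j → c j ∈ us
  c∈us j = ∈-map⁺ c (∈-allFin j)

  module G = Greedy T forest X indep (_∈ L) P (3 + r) κ us
    (subst (λ l → V T + (e T * (3 + r) + l) ≤ κ) (sym (trans (length-map c (allFin (length W))) (length-allFin (length W)))) κ-large)
    (λ D∈ → ≤-reflexive (size D∈)) spread
  open G.Embedding G.embedding renaming (φ to φ₀; D to D₀; φ-inj to φ₀-inj; φ-us₀ to φ₀∉us)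

  val : ∀ {w} → w ∈ W → Fin n
  val p = c (index p)

  val-inj : ∀ {w w′} (p : w ∈ W) (q : w′ ∈ W) → val p ≡ val q → w ≡ w′
  val-inj p q eq = index-injective p q (c-inj eq)

  φ : Fin (V T) → Fin n
  φ v with v ∈? X
  ... | yes v∈ = val (vertex∈W v∈)
  ... | no _   = φ₀ v

  φ-in : ∀ {v} → v ∈ˢ X → Σ (inj₁ v ∈ W) λ p → φ v ≡ val p
  φ-in {v} v∈ with v ∈? X
  ... | yes p = vertex∈W p , refl
  ... | no ¬p = contradiction v∈ ¬p

  φ-out : ∀ {v} → v ∉ˢ X → φ v ≡ φ₀ v
  φ-out {v} v∉ with v ∈? X
  ... | yes p = contradiction p v∉
  ... | no _ = refl

  φ₀≢c : ∀ v j → φ₀ v ≢ c j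
  φ₀≢c v j eq = φ₀∉us v (subst (_∈ us) (sym eq) (c∈us j))

  φ-inj : ∀ {v w} → φ v ≡ φ w → v ≡ w
  φ-inj {v} {w} eq with v ∈? X | w ∈? X
  ... | yes p | yes q with val-inj (vertex∈W p) (vertex∈W q) eq
  ...   | refl = refl
  φ-inj {v} {w} eq | yes p | no q = contradiction (sym eq) (φ₀≢c w _)
  φ-inj {v} {w} eq | no p | yes q = contradiction eq (φ₀≢c v _)
  φ-inj {v} {w} eq | no p | no q = φ₀-inj eq

  -- The constant that completes the set of edge `i`: that of its end in `X` if there is one,
  -- otherwise the one reserved for `i` itself. Independence of `X` makes the first choice
  -- unambiguous.
  data Tag (i : Fin (e T)) (z : Fin n) : Set where
    vertex : ∀ {v} → v ∈ˢ X → End T i v → z ≡ φ v → Tag i z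
    edge   : Untouched i → (p : inj₂ i ∈ W) → z ≡ val p → Tag i z

  tag : ∀ i → ∃ (Tag i)
  tag i with end T false i ∈? X | end T true i ∈? X
  ... | yes p | _ = _ , vertex p (inj₁ refl) refl
  ... | no _ | yes q = _ , vertex q (inj₂ refl) refl
  ... | no p | no q = _ , edge (p , q) (edge∈W (p , q)) refl

  z : Fin (e T) → Fin n
  z i = proj₁ (tag i)

  X-end-unique : ∀ {i v w} → v ∈ˢ X → w ∈ˢ X → End T i v → End T i w → v ≡ w
  X-end-unique v∈ w∈ (inj₁ refl) (inj₁ refl) = refl
  X-end-unique {i} v∈ w∈ (inj₁ refl) (inj₂ refl) = contradiction w∈ (indep i v∈)
  X-end-unique {i} v∈ w∈ (inj₂ refl) (inj₁ refl) = contradiction v∈ (indep i w∈)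
  X-end-unique v∈ w∈ (inj₂ refl) (inj₂ refl) = refl

  z-c : ∀ i → ∃ λ j → z i ≡ c j
  z-c i with tag i
  ... | _ , vertex v∈ _ refl = let (p , eq) = φ-in v∈ in index p , eq
  ... | _ , edge _ p refl = index p , refl

  z-φ⁺ : ∀ {i v} → v ∈ˢ X → End T i v → φ v ≡ z i
  z-φ⁺ {i} v∈ en with tag i
  ... | _ , vertex w∈ en′ refl = cong φ (X-end-unique v∈ w∈ en en′)
  z-φ⁺ {i} v∈ (inj₁ refl) | _ , edge (a , _) p refl = contradiction v∈ a
  z-φ⁺ {i} v∈ (inj₂ refl) | _ , edge (_ , b) p refl = contradiction v∈ b

  z-φ⁻ : ∀ {i v} → φ v ≡ z i → End T i v
  z-φ⁻ {i} {v} eq with tag i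
  ... | _ , vertex w∈ en′ refl = subst (End T i) (sym (φ-inj eq)) en′
  ... | _ , edge _ p refl with v ∈? X
  ...   | yes q with val-inj (vertex∈W q) p eq
  ...     | ()
  z-φ⁻ {i} {v} eq | _ , edge _ p refl | no q = contradiction eq (φ₀≢c v _)

  -- Constants reserved for edges are pairwise distinct, so two edges can share only the constant of
  -- a vertex of `X`.
  z-meet : ∀ {i j} → i ≢ j → z i ≡ z j → ∃ λ v → z i ≡ φ v
  z-meet {i} {j} i≢j eq with tag i | tag j
  ... | _ , vertex {v} _ _ refl | _ = v , refl
  ... | _ , edge _ _ refl | _ , vertex {v} _ _ refl = v , eq
  ... | _ , edge _ p refl | _ , edge _ q refl with val-inj p q eq
  ...   | refl = contradiction refl i≢j

  z∉D₀ : ∀ i j → z i ∉ˢ D₀ j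
  z∉D₀ i j h = let (l , eq) = z-c i in D-us₀ ∈⊤ h (subst (_∈ us) (sym eq) (c∈us l))

  D : Fin (e T) → Subset n
  D i = D₀ i ∪ ⁅ z i ⁆

  D⁻ : ∀ {i y} → y ∈ˢ D i → y ∈ˢ D₀ i ⊎ y ≡ z i
  D⁻ {i} {y} h with x∈p∪q⁻ (D₀ i) ⁅ z i ⁆ h
  ... | inj₁ p = inj₁ p
  ... | inj₂ p = inj₂ (x∈⁅y⁆⇒x≡y (z i) p)

  setEmbedding : SetEmbedding F T
  setEmbedding = record
    { φ = φ ; D = D ; φ-inj = φ-inj
    ; mem = λ i → let (j , eq) = z-c i in subst (λ y → D₀ i ∪ ⁅ y ⁆ ∈ edges F) (sym eq) (c-ext (mem ∈⊤) j)
    ; inc⁺ = inc⁺′ ; inc⁻ = inc⁻′ ; meet = meet′ }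
    where
    inc⁺′ : ∀ {i v} → End T i v → φ v ∈ˢ D i
    inc⁺′ {i} {v} en = cases (v ∈? X)
      where
      cases : Dec (v ∈ˢ X) → φ v ∈ˢ D i
      cases (yes v∈) = x∈p∪q⁺ (inj₂ (subst (_∈ˢ ⁅ z i ⁆) (sym (z-φ⁺ {i} v∈ en)) (x∈⁅x⁆ (z i))))
      cases (no v∉) = x∈p∪q⁺ (inj₁ (subst (_∈ˢ D₀ i) (sym (φ-out v∉)) (inc⁺ ∈⊤ en v∉)))
    inc⁻′ : ∀ {i v} → φ v ∈ˢ D i → End T i v
    inc⁻′ {i} {v} h = cases (D⁻ h) (v ∈? X)
      where
      cases : φ v ∈ˢ D₀ i ⊎ φ v ≡ z i → Dec (v ∈ˢ X) → End T i v
      cases (inj₂ eq) _ = z-φ⁻ eq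
      cases (inj₁ h) (yes v∈) = let (p , eq) = φ-in v∈ in contradiction (c∈us (index p)) (D-us₀ ∈⊤ (subst (_∈ˢ D₀ i) eq h))
      cases (inj₁ h) (no v∉) = proj₁ (inc⁻ ∈⊤ (subst (_∈ˢ D₀ i) (φ-out v∉) h))
    meet′ : ∀ {i j y} → i ≢ j → y ∈ˢ D i → y ∈ˢ D j → ∃ λ v → y ≡ φ v
    meet′ {i} {j} i≢j h k with D⁻ {i} h | D⁻ {j} k
    ... | inj₁ p | inj₁ q = let (v , eq) = meet ∈⊤ ∈⊤ i≢j p q in
      v , trans eq (sym (φ-out (proj₂ (inc⁻ ∈⊤ (subst (_∈ˢ D₀ i) eq p)))))
    ... | inj₁ p | inj₂ refl = contradiction p (z∉D₀ j i)
    ... | inj₂ refl | inj₁ q = contradiction q (z∉D₀ i j)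
    ... | inj₂ refl | inj₂ eq = z-meet i≢j eq

  expansion : ContainsExpansion F T
  expansion = containsExpansion {F = F} {T = T} setEmbedding

-- The upper bound.

choice : {A B : Set} (_≟A_ : DecidableEquality A) {Q : A → B → Set} → B → (xs : List A) →
  (∀ {x} → x ∈ xs → ∃ (Q x)) → Σ (A → B) λ f → ∀ {x} → x ∈ xs → Q x (f x)
choice {A} {B} _≟A_ {Q} b₀ xs h = f , f-ok
  where
  open import Data.List.Membership.DecPropositional _≟A_ using () renaming (_∈?_ to _∈ᴸ?_)
  f : A → B
  f x with x ∈ᴸ? xs
  ... | yes x∈ = proj₁ (h x∈)
  ... | no _   = b₀
  f-ok : ∀ {x} → x ∈ xs → Q x (f x)
  f-ok {x} x∈ with x ∈ᴸ? xs
  ... | yes p = proj₂ (h p)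
  ... | no ¬p = contradiction x∈ ¬p

sum-≤-split : {A : Set} {P : A → Set} (P? : Decidable P) (f : A → ℕ) (a c : ℕ) (xs : List A) →
  (∀ {x} → x ∈ xs → ¬ P x → f x ≤ a) → (∀ {x} → x ∈ xs → P x → f x ≤ c) →
  sum (map f xs) ≤ length xs * a + # P? xs * c
sum-≤-split P? f a c [] lo hi = z≤n
sum-≤-split P? f a c (x ∷ xs) lo hi with P? x | sum-≤-split P? f a c xs (lo ∘ there) (hi ∘ there)
... | yes p | ih = begin
    f x + sum (map f xs)                       ≤⟨ +-mono-≤ (hi (here refl) p) ih ⟩
    c + (length xs * a + # P? xs * c)          ≡⟨ +-exchange c (length xs * a) _ ⟩
    length xs * a + (c + # P? xs * c)          ≤⟨ +-monoˡ-≤ _ (m≤n+m _ a) ⟩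
    a + length xs * a + (c + # P? xs * c)      ∎
  where open ≤-Reasoning
... | no p | ih = begin
    f x + sum (map f xs)                       ≤⟨ +-mono-≤ (lo (here refl) p) ih ⟩
    a + (length xs * a + # P? xs * c)          ≡⟨ +-assoc a _ _ ⟨
    a + length xs * a + # P? xs * c            ∎
  where open ≤-Reasoning

c[q]≥1 : ∀ q → 1 ≤ c[ q ]
c[q]≥1 zero = s≤s z≤n
c[q]≥1 (suc q) = *-mono-≤ (*-mono-≤ (m^n>0 2 q) (c[q]≥1 q)) (s≤s {n = q} z≤n)

module UpperBound (T : Graph) (forest : IsForest T) (X : Subset (V T))
  (indep : ∀ i → end T false i ∈ˢ X → end T true i ∉ˢ X) (r : ℕ) (i₀ : Fin (e T)) where

  open Weight T X using (W; W-nonempty)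

  -- `κ` covers both uses of the greedy embedding: with edges of size `4 + r`, and with sets of size
  -- `3 + r` and `s` constants to be avoided.
  s κ : ℕ
  s = length W
  κ = V T + (e T * (4 + r) + s)

  1≤s : 1 ≤ s
  1≤s = W-nonempty i₀

  1≤κ : 1 ≤ κ
  1≤κ = ≤-trans 1≤s (≤-trans (m≤n+m s (e T * (4 + r))) (m≤n+m _ (V T)))

  κ-large₁ : V T + e T * (4 + r) ≤ κ
  κ-large₁ = +-monoʳ-≤ (V T) (m≤m+n _ s)

  κ-large₂ : V T + (e T * (3 + r) + s) ≤ κ
  κ-large₂ = +-monoʳ-≤ (V T) (+-monoˡ-≤ s (*-monoʳ-≤ (e T) (n≤1+n (3 + r))))

  record Extensions {n : ℕ} (F : UHypergraph (4 + r) n) (L : List (Subset n)) : Set where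
    field
      L-unique : Unique L
      size     : ∀ {D} → D ∈ L → ∣ D ∣ ≡ 3 + r
      x        : Fin s → Subset n → Fin n
      x∉       : ∀ {D} → D ∈ L → ∀ j → x j D ∉ˢ D
      x-ext    : ∀ {D} → D ∈ L → ∀ j → D ∪ ⁅ x j D ⁆ ∈ edges F
      x-inj    : ∀ {D} → D ∈ L → ∀ {i j} → x i D ≡ x j D → i ≡ j

  -- Invariant: the extension functions x j with j ≥ i are already constant on L.
  extensions⇒expansion : ∀ i → i ≤ s → ∀ d → 1 ≤ d → Σ ℕ λ N → ∀ {n} → N ≤ n →
    (F : UHypergraph (4 + r) n) (L : List (Subset n)) (Ex : Extensions F L) →
    n ^ (3 + r) ≤ d * length L →
    (∀ j → i ≤ toℕ j → ∃ λ u → ∀ {D} → D ∈ L → Extensions.x Ex j D ≡ u) →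
    ContainsExpansion F T
  extensions⇒expansion zero _ d 1≤d = suc (d * κ) , base
    where
    base : ∀ {n} → suc (d * κ) ≤ n → (F : UHypergraph (4 + r) n) (L : List (Subset n)) (Ex : Extensions F L) →
      n ^ (3 + r) ≤ d * length L → (∀ j → 0 ≤ toℕ j → ∃ λ u → ∀ {D} → D ∈ L → Extensions.x Ex j D ≡ u) →
      ContainsExpansion F T
    base {n} n-large F L Ex dense const =
      ConstantExtensions.expansion T forest X indep F κ c c-inj κ-large₂ L size
        (λ {D} D∈ j → subst (λ u → D ∪ ⁅ u ⁆ ∈ edges F) (proj₂ (const j z≤n) D∈) (x-ext D∈ j))
        (proj₂ (dense⇒spread κ d n-large L L-unique size dense))
      where
      open Extensions Ex
      c : Fin s → Fin n
      c j = proj₁ (const j z≤n)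
      nonempty : ∀ m → n ^ (3 + r) ≤ d * m → 1 ≤ m
      nonempty zero le = contradiction
        (≤-trans (m^n>0 n {{>-nonZero (≤-trans (s≤s z≤n) n-large)}} (3 + r)) (≤-trans le (≤-reflexive (*-zeroʳ d)))) λ ()
      nonempty (suc m) le = s≤s z≤n
      -- By density `L` has a member, and there the constants are `s` distinct extra vertices.
      c-inj : ∀ {i j} → c i ≡ c j → i ≡ j
      c-inj {i} {j} eq = let (D , D∈) = length>0⇒∃ (nonempty (length L) dense) in
        x-inj D∈ (trans (proj₂ (const i z≤n) D∈) (trans eq (sym (proj₂ (const j z≤n) D∈))))
  extensions⇒expansion (suc i) i<s d 1≤d = suc (4 * d * κ) ⊔ proj₁ ih , step
    where
    d′ : ℕ
    -- The factor that `dichotomy` returns. Taking `ih` at it keeps the threshold independent of `n`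
    -- and `F`.
    d′ = 2 * d * (4 * d * κ) * (4 * d * κ) * (3 + r)
    1≤g : 1 ≤ 4 * d * κ
    1≤g = *-mono-≤ (*-mono-≤ (s≤s {n = 3} z≤n) 1≤d) 1≤κ
    ih = extensions⇒expansion i (<⇒≤ i<s) d′
      (*-mono-≤ (*-mono-≤ (*-mono-≤ (*-mono-≤ (s≤s {n = 1} z≤n) 1≤d) 1≤g) 1≤g) (s≤s {n = 2 + r} z≤n))
    step : ∀ {n} → suc (4 * d * κ) ⊔ proj₁ ih ≤ n → (F : UHypergraph (4 + r) n) (L : List (Subset n)) (Ex : Extensions F L) →
      n ^ (3 + r) ≤ d * length L → (∀ j → suc i ≤ toℕ j → ∃ λ u → ∀ {D} → D ∈ L → Extensions.x Ex j D ≡ u) →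
      ContainsExpansion F T
    step {n} n-large F L Ex dense const
      with Dichotomy.dichotomy κ d 1≤κ 1≤d (≤-trans (m≤m⊔n _ (proj₁ ih)) n-large) L L-unique size (x j₀)
             (λ D∈ → x∉ D∈ j₀) dense
      where
      open Extensions Ex
      j₀ = fromℕ< i<s
    ... | inj₁ (P , spread) = spread⇒expansion T forest F κ κ-large₁
          (Spread-mono (λ { (D , D∈ , refl) → x-ext D∈ (fromℕ< i<s) }) spread)
      where open Extensions Ex
    ... | inj₂ (u , dense′) = proj₂ ih (≤-trans (m≤n⊔m (suc (4 * d * κ)) (proj₁ ih)) n-large) F L′ Ex′ dense′ const′
      where
      open Extensions Ex
      j₀ = fromℕ< i<s
      u? : ∀ D → Dec (x j₀ D ≡ u)
      u? D = x j₀ D Finₚ.≟ u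
      L′ = filter u? L
      L′⁻ : ∀ {D} → D ∈ L′ → D ∈ L × x j₀ D ≡ u
      L′⁻ = ∈-filter⁻ u? {xs = L}
      Ex′ : Extensions F L′
      Ex′ = record
        { L-unique = Uniqueₚ.filter⁺ u? L-unique
        ; size = λ D∈ → size (proj₁ (L′⁻ D∈))
        ; x = x
        ; x∉ = λ D∈ → x∉ (proj₁ (L′⁻ D∈))
        ; x-ext = λ D∈ → x-ext (proj₁ (L′⁻ D∈))
        ; x-inj = λ D∈ → x-inj (proj₁ (L′⁻ D∈)) }
      const′ : ∀ j → i ≤ toℕ j → ∃ λ w → ∀ {D} → D ∈ L′ → x j D ≡ w
      const′ j i≤j with toℕ j ≟ i
      ... | no ≢i = let (w , h) = const j (≤∧≢⇒< i≤j (≢i ∘ sym)) in w , λ D∈ → h (proj₁ (L′⁻ D∈))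
      ... | yes ≡i = u , λ {D} D∈ → trans (cong (λ l → x l D) (Finₚ.toℕ-injective (trans ≡i (sym (Finₚ.toℕ-fromℕ< i<s))))) (proj₂ (L′⁻ D∈))

  -- A set charged with fewer than `s` edges absorbs at most `s ∸ 1`. An excess of more than `1/m`
  -- edges per set must therefore sit on the rich sets, each charged at most `κ` times, so a
  -- proportion of at least `1 / (m * κ)` is rich; the factor `c[ 3 + r ]` in `d` passes from
  -- binomials to powers.
  upperBound : ∀ m → 1 ≤ m → Σ ℕ λ N → ∀ {n} → N ≤ n → (F : UHypergraph (4 + r) n) → ¬ ContainsExpansion F T →
    m * length (edges F) ≤ (m * (s ∸ 1) + 1) * (n C (3 + r))
  upperBound m 1≤m = suc (3 + r) ⊔ proj₁ main , bound
    where
    d : ℕ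
    d = c[ 3 + r ] * (m * κ)
    main = extensions⇒expansion s ≤-refl d (*-mono-≤ (c[q]≥1 (3 + r)) (*-mono-≤ 1≤m 1≤κ))
    bound : ∀ {n} → suc (3 + r) ⊔ proj₁ main ≤ n → (F : UHypergraph (4 + r) n) → ¬ ContainsExpansion F T →
      m * length (edges F) ≤ (m * (s ∸ 1) + 1) * (n C (3 + r))
    bound {n} n-large F free
      with prune _≟ˢ_ _⊆?_ ss κ ∅ (length (edges F)) (edges F) (distinct F) ≤-refl
      where ss = subsetsOfSize n (3 + r)
    ... | inj₁ (L , ne , uq , sub , full) = contradiction
      (spread⇒expansion T forest F κ κ-large₁ (Spread-mono sub
        (proj₂ (full⇒spread κ L uq (λ D∈ → All.lookup (uniform F) (sub D∈)) (s≤s z≤n) ne full)))) free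
    ... | inj₂ (a , ok , fib) with m * length (edges F) ≤? (m * (s ∸ 1) + 1) * (n C (3 + r))
    ...   | yes h = h
    -- The descent starts at `s`, where no index lies beyond and the invariant is vacuous.
    ...   | no ¬h = contradiction (proj₂ main (≤-trans (m≤n⊔m (suc (3 + r)) (proj₁ main)) n-large) F L Ex dense (λ j s≤j → contradiction (Finₚ.toℕ<n j) (≤⇒≯ s≤j))) free
      where
      ss = subsetsOfSize n (3 + r)
      binom = n C (3 + r)
      deg : Subset n → ℕ
      deg D = # (λ S → a S ≟ˢ D) (edges F)
      rich? : ∀ D → Dec (s ≤ deg D)
      rich? D = s ≤? deg D
      L = filter rich? ss
      L⁻ : ∀ {D} → D ∈ L → D ∈ ss × s ≤ deg D
      L⁻ = ∈-filter⁻ rich? {xs = ss}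
      total : length (edges F) ≤ binom * (s ∸ 1) + length L * κ
      total = begin
        length (edges F)                       ≤⟨ length≤sum-# (λ D S → a S ≟ˢ D) (edges F) ss (λ S∈ → _ , proj₁ (ok S∈) , refl) ⟩
        sum (map deg ss)                       ≤⟨ sum-≤-split rich? deg (s ∸ 1) κ ss (λ _ ¬rich → pred-mono-≤ (≰⇒> ¬rich)) (λ {D} _ _ → fib D) ⟩
        length ss * (s ∸ 1) + length L * κ     ≡⟨ cong (λ l → l * (s ∸ 1) + length L * κ) (length-subsetsOfSize n (3 + r)) ⟩
        binom * (s ∸ 1) + length L * κ             ∎
        where open ≤-Reasoning
      binom≤ : binom ≤ m * κ * length L
      binom≤ = <⇒≤ (+-cancelˡ-< (m * (s ∸ 1) * binom) _ _ (begin-strict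
        m * (s ∸ 1) * binom + binom                         ≡⟨ r₁ (m * (s ∸ 1)) binom ⟩
        (m * (s ∸ 1) + 1) * binom                       <⟨ ≰⇒> ¬h ⟩
        m * length (edges F)                        ≤⟨ *-monoʳ-≤ m total ⟩
        m * (binom * (s ∸ 1) + length L * κ)            ≡⟨ r₂ m binom (s ∸ 1) (length L) κ ⟩
        m * (s ∸ 1) * binom + m * κ * length L          ∎))
        where
        open ≤-Reasoning
        r₁ : ∀ a b → a * b + b ≡ (a + 1) * b
        r₁ = solve-∀
        r₂ : ∀ m binom t l κ → m * (binom * t + l * κ) ≡ m * t * binom + m * κ * l
        r₂ = solve-∀
      dense : n ^ (3 + r) ≤ d * length L
      dense = begin
        n ^ (3 + r)                             ≤⟨ n^q≤c*nCq n (3 + r) (≤-trans (n≤1+n (3 + r)) (≤-trans (m≤m⊔n _ (proj₁ main)) n-large)) ⟩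
        c[ 3 + r ] * binom                          ≤⟨ *-monoʳ-≤ c[ 3 + r ] binom≤ ⟩
        c[ 3 + r ] * (m * κ * length L)         ≡⟨ *-assoc c[ 3 + r ] (m * κ) (length L) ⟨
        d * length L                            ∎
        where open ≤-Reasoning
      Good : Subset n → (Fin s → Fin n) → Set
      Good D v = (∀ j → v j ∉ˢ D) × (∀ j → D ∪ ⁅ v j ⁆ ∈ edges F) × (∀ {i j} → v i ≡ v j → i ≡ j)
      good : ∀ {D} → D ∈ L → ∃ (Good D)
      good {D} D∈ = (λ j → proj₁ (ext j)) , (λ j → proj₁ (proj₂ (ext j))) ,
          (λ j → subst (_∈ edges F) (proj₂ (proj₂ (ext j))) (proj₁ (∈-filter⁻ D? {xs = edges F} (S∈ j)))) ,
          λ {i} {j} eq → Finₚ.inject≤-injective _ _ i j (lookup-injective (Uniqueₚ.filter⁺ D? (distinct F))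
            (trans (proj₂ (proj₂ (ext i))) (trans (cong (λ u → D ∪ ⁅ u ⁆) eq) (sym (proj₂ (proj₂ (ext j)))))))
        where
        D? : ∀ S → Dec (a S ≡ D)
        D? S = a S ≟ˢ D
        -- The first `s` edges charged to `D`; being distinct, they have distinct extra vertices.
        S : Fin s → Subset n
        S j = lookup (filter D? (edges F)) (inject≤ j (proj₂ (L⁻ D∈)))
        S∈ : ∀ j → S j ∈ filter D? (edges F)
        S∈ j = ∈-lookup (inject≤ j (proj₂ (L⁻ D∈)))
        ext : ∀ j → ∃ λ u → u ∉ˢ D × S j ≡ D ∪ ⁅ u ⁆
        ext j with ∈-filter⁻ D? {xs = edges F} (S∈ j)
        ... | S∈F , eq = ⊆∧∣∣≡1+⇒∪ (λ {y} y∈ → proj₂ (ok S∈F) {y} (subst (y ∈ˢ_) (sym eq) y∈))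
          (trans (All.lookup (uniform F) S∈F) (cong suc (sym (∈-subsetsOfSize⁻ (3 + r) (proj₁ (L⁻ D∈))))))
      chosen = choice _≟ˢ_ (λ _ → fromℕ< {0} (≤-trans (s≤s z≤n) (≤-trans (m≤m⊔n _ (proj₁ main)) n-large))) L good
      Ex : Extensions F L
      Ex = record
        { L-unique = Uniqueₚ.filter⁺ rich? (subsetsOfSize-unique n (3 + r))
        ; size = λ D∈ → ∈-subsetsOfSize⁻ (3 + r) (proj₁ (L⁻ D∈))
        ; x = λ j D → proj₁ chosen D j
        ; x∉ = λ D∈ → proj₁ (proj₂ chosen D∈)
        ; x-ext = λ D∈ → proj₁ (proj₂ (proj₂ chosen D∈))
        ; x-inj = λ D∈ → proj₂ (proj₂ (proj₂ chosen D∈)) }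

-- The lower bound: stars around a fixed set of centres.

pad : {r : ℕ} (t : ℕ) → Subset r → Subset (t + r)
pad zero    S = S
pad (suc t) S = outside ∷ pad t S

∣pad∣ : {r : ℕ} (t : ℕ) (S : Subset r) → ∣ pad t S ∣ ≡ ∣ S ∣
∣pad∣ zero S = refl
∣pad∣ (suc t) S = ∣pad∣ t S

pad-injective : {r : ℕ} (t : ℕ) {S S′ : Subset r} → pad t S ≡ pad t S′ → S ≡ S′
pad-injective zero eq = eq
pad-injective (suc t) eq = pad-injective t (Vecₚ.∷-injectiveʳ eq)

∈-pad⇒≥ : {r : ℕ} (t : ℕ) (S : Subset r) {i : Fin (t + r)} → i ∈ˢ pad t S → t ≤ toℕ i
∈-pad⇒≥ zero S i∈ = z≤n
∈-pad⇒≥ (suc t) S (there i∈) = s≤s (∈-pad⇒≥ t S i∈)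

-- The sets of size 1 + q with exactly one element among the first t.
stars : (t r q : ℕ) → List (Subset (t + r))
stars zero    r q = []
stars (suc t) r q = map (λ S → inside ∷ pad t S) (subsetsOfSize r q) ++ map (outside ∷_) (stars t r q)

length-stars : ∀ t r q → length (stars t r q) ≡ t * (r C q)
length-stars zero r q = refl
length-stars (suc t) r q = trans (length-++ (map (λ S → inside ∷ pad t S) (subsetsOfSize r q)))
  (cong₂ _+_ (trans (length-map (λ S → inside ∷ pad t S) (subsetsOfSize r q)) (length-subsetsOfSize r q))
             (trans (length-map (outside ∷_) (stars t r q)) (length-stars t r q)))

stars-unique : ∀ t r q → Unique (stars t r q)
stars-unique zero r q = []
stars-unique (suc t) r q = Uniqueₚ.++⁺
  (Uniqueₚ.map⁺ (λ eq → pad-injective t (Vecₚ.∷-injectiveʳ eq)) (subsetsOfSize-unique r q))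
  (Uniqueₚ.map⁺ Vecₚ.∷-injectiveʳ (stars-unique t r q)) disjoint
  where
  disjoint : ∀ {S} → S ∈ map (λ S → inside ∷ pad t S) (subsetsOfSize r q) × S ∈ map (outside ∷_) (stars t r q) → ⊥
  disjoint (h , k) with ∈-map⁻ (λ S → inside ∷ pad t S) h | ∈-map⁻ (outside ∷_) k
  ... | _ , _ , refl | _ , _ , ()

record Star (t q : ℕ) {n : ℕ} (S : Subset n) : Set where
  field
    card    : ∣ S ∣ ≡ suc q
    center  : ∃ λ i → i ∈ˢ S × toℕ i < t
    central : ∀ {i j} → i ∈ˢ S → j ∈ˢ S → toℕ i < t → toℕ j < t → i ≡ j

∈-stars⁻ : ∀ t {r q S} → S ∈ stars t r q → Star t q S
∈-stars⁻ (suc t) {r} {q} S∈ with ∈-++⁻ (map (λ S → inside ∷ pad t S) (subsetsOfSize r q)) S∈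
... | inj₁ h with ∈-map⁻ (λ S → inside ∷ pad t S) h
...   | S , S∈′ , refl = record
  { card = cong suc (trans (∣pad∣ t S) (∈-subsetsOfSize⁻ q S∈′))
  ; center = fzero , here , s≤s z≤n
  ; central = λ { here here _ _ → refl
                ; (there h) _ (s≤s lt) _ → contradiction (∈-pad⇒≥ t S h) (<⇒≱ lt)
                ; _ (there h) _ (s≤s lt) → contradiction (∈-pad⇒≥ t S h) (<⇒≱ lt) } }
∈-stars⁻ (suc t) {r} {q} S∈ | inj₂ h with ∈-map⁻ (outside ∷_) h
...   | S , S∈′ , refl = record
  { card = card
  ; center = let (i , i∈ , lt) = center in fsuc i , there i∈ , s≤s lt
  ; central = λ { (there h) (there k) (s≤s a) (s≤s b) → cong fsuc (central h k a b) } }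
  where open Star (∈-stars⁻ t S∈′)

starHypergraph : (t r q : ℕ) → UHypergraph (suc q) (t + r)
starHypergraph t r q = record
  { edges = stars t r q
  ; uniform = All.tabulate (λ S∈ → Star.card (∈-stars⁻ t S∈))
  ; distinct = stars-unique t r q }

-- In a copy, let `X` consist of the vertices sent to centres. An edge has only one centre, so `X`
-- is independent; an edge of `T` avoiding `X` has its centre among its own new vertices. The copy
-- thus uses as many centres as the weight of `X`, more than the `t` available.
stars-free : (T : Graph) (t r q : ℕ) →
  ((X : Subset (V T)) → Independent T X → t < ∣ X ∣ + eMinus T X) →
  ¬ ContainsExpansion (starHypergraph t r q) T
stars-free T t r q σ>t (Φ , Φ-inj , h) = contradiction W≤t (<⇒≱ (subst (t <_) (sym length-W) (σ>t X indep)))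
  where
  low? : ∀ v → Dec (toℕ (Φ (inj₁ v)) < t)
  low? v = toℕ (Φ (inj₁ v)) <? t
  X : Subset (V T)
  X = Vec.tabulate (does ∘ low?)
  X⁺ : ∀ {v} → toℕ (Φ (inj₁ v)) < t → v ∈ˢ X
  X⁺ {v} lt = lookup⇒[]= v X (trans (lookup∘tabulate (does ∘ low?) v) (dec-true (low? v) lt))
  X⁻ : ∀ {v} → v ∈ˢ X → toℕ (Φ (inj₁ v)) < t
  X⁻ {v} v∈ = does-true (low? v) (trans (sym (lookup∘tabulate (does ∘ low?) v)) ([]=⇒lookup v∈))
    where
    does-true : ∀ {A : Set} (d : Dec A) → does d ≡ true → A
    does-true (yes a) _ = a
  open Weight T X
  S : Fin (e T) → Subset (t + r)
  S i = proj₁ (h i)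
  star : ∀ i → Star t q (S i)
  star i = ∈-stars⁻ t (proj₁ (proj₂ (h i)))
  from : ∀ i {w} → InExpEdge T (suc q) i w → Φ w ∈ˢ S i
  from i {w} en = Equivalence.from (proj₂ (proj₂ (h i)) (Φ w)) (w , en , refl)
  to : ∀ i {z} → z ∈ˢ S i → Σ (ExpVertex T (suc q)) λ w → InExpEdge T (suc q) i w × Φ w ≡ z
  to i {z} = Equivalence.to (proj₂ (proj₂ (h i)) z)
  notBoth : ∀ i → end T false i ∈ˢ X → end T true i ∈ˢ X → ⊥
  notBoth i a b = end≢end T i (inj₁-injective (Φ-inj
    (Star.central (star i) (from i {inj₁ _} (inj₁ refl)) (from i {inj₁ _} (inj₂ refl)) (X⁻ a) (X⁻ b))))
  indep : Independent T X
  indep = All.tabulate λ {xy} xy∈ (a , b) → notBoth (index xy∈)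
    (subst (λ p → proj₁ p ∈ˢ X) (lookup-index xy∈) a) (subst (λ p → proj₂ p ∈ˢ X) (lookup-index xy∈) b)
  owner : ExpVertex T (suc q) → Fin (V T) ⊎ Fin (e T)
  owner (inj₁ v) = inj₁ v
  owner (inj₂ (i , _)) = inj₂ i
  -- A centre is assigned to the vertex or edge of `T` that owns its preimage; injectivity of `Φ`
  -- makes the owner unique.
  Rel : Fin (V T) ⊎ Fin (e T) → Fin t → Set
  Rel w j = ∃ λ u → owner u ≡ w × toℕ (Φ u) ≡ toℕ j
  Rel-inj : ∀ {w w′ j} → Rel w j → Rel w′ j → w ≡ w′
  Rel-inj (u , refl , p) (u′ , refl , p′) = cong owner (Φ-inj (Finₚ.toℕ-injective (trans p (sym p′))))
  witness : ∀ u → toℕ (Φ u) < t → ∃ λ j → j ∈ allFin t × Rel (owner u) j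
  witness u lt = fromℕ< lt , ∈-allFin _ , u , refl , sym (Finₚ.toℕ-fromℕ< lt)
  cov : ∀ {w} → w ∈ W → ∃ λ j → j ∈ allFin t × Rel w j
  cov w∈ with ∈W⁻ w∈
  ... | inj₁ (v , refl , v∈) = witness (inj₁ v) (X⁻ v∈)
  ... | inj₂ (i , refl , a∉ , b∉) with Star.center (star i)
  ...   | z , z∈ , z<t with to i z∈
  ...     | inj₁ v , inj₁ refl , refl = contradiction (X⁺ z<t) a∉
  ...     | inj₁ v , inj₂ refl , refl = contradiction (X⁺ z<t) b∉
  ...     | inj₂ (i , l) , refl , refl = witness (inj₂ (i , l)) z<t
  W≤t : length W ≤ t
  W≤t = ≤-trans (length-≤-by {f = Rel} W-unique cov Rel-inj) (≤-reflexive (length-allFin t))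

nCq≤[1+n]Cq : ∀ n q → n C q ≤ suc n C q
nCq≤[1+n]Cq n zero = ≤-reflexive (trans (nC0≡1 n) (sym (nC0≡1 (suc n))))
nCq≤[1+n]Cq n (suc q) = ≤-trans (m≤n+m _ (n C q)) (≤-reflexive (nCk+nC[k+1]≡[n+1]C[k+1] n q))

-- Pascal's rule, applied once for each of the `t` added points, with every increment bounded by the
-- largest.
[t+r]Cq≤ : ∀ t r q → (t + r) C suc q ≤ r C suc q + t * ((t + r) C q)
[t+r]Cq≤ zero r q = m≤m+n _ 0
[t+r]Cq≤ (suc t) r q = begin
  suc (t + r) C suc q                                        ≡⟨ nCk+nC[k+1]≡[n+1]C[k+1] (t + r) q ⟨
  (t + r) C q + (t + r) C suc q                              ≤⟨ +-monoʳ-≤ ((t + r) C q) ([t+r]Cq≤ t r q) ⟩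
  (t + r) C q + (r C suc q + t * ((t + r) C q))              ≡⟨ +-exchange ((t + r) C q) (r C suc q) _ ⟩
  r C suc q + suc t * ((t + r) C q)                          ≤⟨ +-monoʳ-≤ (r C suc q) (*-monoʳ-≤ (suc t) (nCq≤[1+n]Cq (t + r) q)) ⟩
  r C suc q + suc t * (suc (t + r) C q)                      ∎
  where open ≤-Reasoning

-- The two binomials have orders `n ^ q` and `n ^ suc q`, so the factor `a` is beaten once `n` is at
-- least `a` times the constant lost in the comparison.
a*nCq≤nC[1+q] : ∀ a n q → c[ suc q ] * a ≤ n → suc q ≤ n → a * (n C q) ≤ n C suc q
a*nCq≤nC[1+q] a n q ca≤n q<n = *-cancelˡ-≤ c[ suc q ] {{>-nonZero (c[q]≥1 (suc q))}} (begin
  c[ suc q ] * (a * (n C q))  ≡⟨ *-assoc c[ suc q ] a (n C q) ⟨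
  c[ suc q ] * a * (n C q)    ≤⟨ *-mono-≤ ca≤n (nCq≤n^q n q) ⟩
  n * n ^ q                   ≤⟨ n^q≤c*nCq n (suc q) q<n ⟩
  c[ suc q ] * (n C suc q)    ∎)
  where open ≤-Reasoning

-- Only `r = n - t` points lie outside the centres, so the stars fall short of `t * (n C suc q)` by
-- at most `t * t * (n C q)`. For large `n`, even `m` times this is at most `n C suc q`.
lowerBound : (T : Graph) (t q m : ℕ) → ((X : Subset (V T)) → Independent T X → t < ∣ X ∣ + eMinus T X) →
  ∀ n → t ⊔ (suc q ⊔ c[ suc q ] * (m * t * t)) ≤ n →
  Σ (UHypergraph (2 + q) n) λ F → ¬ ContainsExpansion F T ×
    (m * t * (n C suc q) ≤ m * length (edges F) + n C suc q)
lowerBound T t q m σ>t n n-large with m≤n⇒∃[o]m+o≡n (≤-trans (m≤m⊔n t _) n-large)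
... | r , refl = starHypergraph t r (suc q) , stars-free T t r (suc q) σ>t , (begin
    m * t * (n C suc q)                                    ≤⟨ *-monoʳ-≤ (m * t) ([t+r]Cq≤ t r q) ⟩
    m * t * (r C suc q + t * (n C q))                      ≡⟨ r₁ m t (r C suc q) (n C q) ⟩
    m * (t * (r C suc q)) + m * t * t * (n C q)            ≤⟨ +-mono-≤ (≤-reflexive (cong (m *_) (sym (length-stars t r (suc q)))))
                                                                (a*nCq≤nC[1+q] (m * t * t) n q
                                                                  (≤-trans (m≤n⊔m (suc q) _) big) (≤-trans (m≤m⊔n (suc q) (c[ suc q ] * (m * t * t))) big)) ⟩
    m * length (stars t r (suc q)) + n C suc q             ∎)
  where
  open ≤-Reasoning
  big : suc q ⊔ c[ suc q ] * (m * t * t) ≤ n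
  big = ≤-trans (m≤n⊔m t _) n-large
  r₁ : ∀ m t a b → m * t * (a + t * b) ≡ m * (t * a) + m * t * t * b
  r₁ = solve-∀

-- The integer `m` stands for an error of `1/m`: divided by `m`, the inequalities say that the
-- extremal number lies within `1/m` of `s ∸ 1` times the binomial coefficient, for all large `n`.
theorem4p1 : (T : Graph) → IsForest T → 1 ≤ e T → (k : ℕ) → 4 ≤ k →
    (s : ℕ) → IsSigma T s →
    (m : ℕ) → 1 ≤ m →
    Σ ℕ λ N → (n : ℕ) → N ≤ n →
    ((F : UHypergraph k n) → ¬ ContainsExpansion F T →
    m * length (edges F) ≤ (m * (s ∸ 1) + 1) * (n C (k ∸ 1)))
    × (Σ (UHypergraph k n) λ F → ¬ ContainsExpansion F T ×
    (m * (s ∸ 1) * (n C (k ∸ 1)) ≤ m * length (edges F) + n C (k ∸ 1)))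
theorem4p1 T forest 1≤e k 4≤k s ((X , indep , refl) , σ-min) m 1≤m with m≤n⇒∃[o]m+o≡n 4≤k
... | r , refl = proj₁ upper ⊔ (t ⊔ (suc (2 + r) ⊔ c[ 3 + r ] * (m * t * t))) , λ n n-large →
    (λ F free → subst (λ l → m * length (edges F) ≤ (m * (l ∸ 1) + 1) * (n C (3 + r))) length-W
      (proj₂ upper (≤-trans (m≤m⊔n (proj₁ upper) _) n-large) F free)) ,
    lowerBound T t (2 + r) m σ>t n (≤-trans (m≤n⊔m (proj₁ upper) _) n-large)
  where
  open Weight T X using (length-W; W-nonempty)
  i₀ : Fin (e T)
  i₀ = fromℕ< 1≤e
  t = ∣ X ∣ + eMinus T X ∸ 1
  indep′ : ∀ i → end T false i ∈ˢ X → end T true i ∉ˢ X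
  indep′ i a b = All.lookup indep (∈-lookup i) (a , b)
  upper = UpperBound.upperBound T forest X indep′ r i₀ m 1≤m
  σ>t : (Y : Subset (V T)) → Independent T Y → t < ∣ Y ∣ + eMinus T Y
  -- As `T` has an edge, the weight of `X` is positive, so the truncated subtraction in `t` is a
  -- genuine one.
  σ>t Y indepY = ≤-trans (≤-reflexive (m+[n∸m]≡n (subst (1 ≤_) length-W (W-nonempty i₀)))) (σ-min Y indepY)
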